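{- Every $(d,\Delta)$-degenerate graph $H$ with $n$ vertices and chromatic number $q$ satisfies $$r(H)\leq \left(2^{7d+8}d^{3d+2}\Delta\right)^{\log q} n.$$
   Context: The Ramsey number $r(H)$ is the least positive integer $N$ such that every two-coloring of the edges of $K_N$ contains a monochromatic copy of $H$. A graph $H$ is $(d,\Delta)$-degenerate if there is an ordering $v_1,\ldots,v_n$ of its vertices such that for each $v_i$: (1) at most $d$ vertices $v_j$ with $j<i$ are adjacent to $v_i$, and (2) there are at most $\Delta$ subsets $S\subset\{v_1,\ldots,v_i\}$ such that $S=N(v_j)\cap\{v_1,\ldots,v_i\}$ for some neighbor $v_j$ of $v_i$ with $j>i$, where $N(v)$ is the set of neighbors of $v$. Logarithms are base $2$. -}

module Defs where

open import Data.Nat using (ℕ; zero; suc; _+_; _*_; _^_; _≤_; _<_)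
open import Data.Nat.Properties using (_≤?_)
open import Data.Fin using (Fin; toℕ)
open import Data.Fin.Subset using (Subset)
open import Data.Bool using (Bool; true; false; _∧_)
open import Data.Vec using (tabulate)
open import Data.List using (List; length; filterᵇ; allFin)
open import Data.List.Membership.Propositional using (_∈_)
open import Data.Product using (Σ; ∃; ∃-syntax; _×_)
open import Relation.Nullary.Decidable using (⌊_⌋)
open import Relation.Binary.PropositionalEquality using (_≡_; _≢_)
open import Function.Definitions using (Injective)

record Graph (n : ℕ) : Set where
  field
    adj   : Fin n → Fin n → Bool
    sym   : ∀ u v → adj u v ≡ adj v u
    irrefl : ∀ u → adj u u ≡ false
open Graph public

countFin : {n : ℕ} → (Fin n → Bool) → ℕ
countFin {n} p = length (filterᵇ p (allFin n))

-- (d,Δ)-degenerate.  The ordering v_1,…,v_n is an injective (hence bijective)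
-- map  ord : Fin n → Fin n  sending position i to the vertex v_i.
-- Condition (2): the set { N(v_j) ∩ {v_1..v_i} : j > i, v_j ~ v_i } has at most Δ
-- elements, expressed as: it is covered by a list of at most Δ subsets.
-- Subsets of {v_1..v_i} are recorded in position coordinates (Subset n).
trace : {n : ℕ} → (H : Graph n) → (Fin n → Fin n) → Fin n → Fin n → Subset n
trace H ord i j = tabulate (λ k → adj H (ord j) (ord k) ∧ ⌊ toℕ k ≤? toℕ i ⌋)

Degenerate : {n : ℕ} → ℕ → ℕ → Graph n → Set
Degenerate {n} d Δ H =
  Σ (Fin n → Fin n) λ ord → Injective _≡_ _≡_ ord ×
    (∀ (i : Fin n) →
       countFin (λ j → adj H (ord j) (ord i) ∧ ⌊ suc (toℕ j) ≤? toℕ i ⌋) ≤ d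
     × ∃[ L ] (length L ≤ Δ ×
          (∀ (j : Fin n) → toℕ i < toℕ j → adj H (ord j) (ord i) ≡ true →
             trace H ord i j ∈ L)))

ProperColouring : {n : ℕ} → Graph n → (q : ℕ) → Set
ProperColouring {n} H q =
  Σ (Fin n → Fin q) λ c → ∀ u v → adj H u v ≡ true → c u ≢ c v

IsChromaticNumber : {n : ℕ} → Graph n → ℕ → Set
IsChromaticNumber H q = ProperColouring H q × (∀ m → ProperColouring H m → q ≤ m)

EdgeColouring : ℕ → Set
EdgeColouring N = Σ (Fin N → Fin N → Bool) λ col → ∀ x y → col x y ≡ col y x

Arrows : {n : ℕ} → ℕ → Graph n → Set
Arrows {n} N H = ∀ (c : EdgeColouring N) → ∃[ b ] Σ (Fin n → Fin N) λ f →
  Injective _≡_ _≡_ f × (∀ u v → adj H u v ≡ true → Data.Product.proj₁ c (f u) (f v) ≡ b)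

IsRamseyNumber : {n : ℕ} → Graph n → ℕ → Set
IsRamseyNumber H N = 1 ≤ N × Arrows N H × (∀ M → 1 ≤ M → Arrows M H → N ≤ M)

-- x ↦ 0^x with the convention 0^0 = 1, evaluated at x = log q (q ≥ 1):
-- equals 1 if q = 1, and 0 if q ≥ 2.
zeroPowLog : ℕ → ℕ
zeroPowLog 1 = 1
zeroPowLog _ = 0

-- LeRealPow R n X q  means the real inequality  R ≤ X^(log₂ q) · n  (for q ≥ 1).
-- For X ≥ 1: X^(log q) = inf { X^(c/e) : c/e ≥ log q } = inf { X^(c/e) : q^e ≤ 2^c },
-- so the inequality holds iff R^e ≤ n^e X^c whenever e ≥ 1 and q^e ≤ 2^c.
LeRealPow : ℕ → ℕ → ℕ → ℕ → Set
LeRealPow R n zero q = R ≤ zeroPowLog q * n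
LeRealPow R n (suc X) q =
  ∀ (c e : ℕ) → 1 ≤ e → q ^ e ≤ 2 ^ c → R ^ e ≤ n ^ e * suc X ^ c

{-# OPTIONS --safe #-}
module Submission where

{-
Fix a 2-colouring without a red copy of H and put R = 8 d q², L = 2 R^d.

Embed H greedily in red inside a set U, keeping for every unplaced vertex a candidate set that loses
at most a factor R for each placed neighbour.  The vertex at position i can only fail because, for one
of the at most Δ traces, too many candidates are bad for the common candidate set B of that trace.
So U contains A, B with |A| ≥ |U| / (L Δ) and |B| ≥ |U| / R^d such that every vertex of A has at most
|B| / R red neighbours in B.

Take a family of ⌊q/2⌋ sets in A, discard the at most half of B with large red degree into it, and take
⌈q/2⌉ sets in the rest of B.  Recursively this gives q sets of size 4 n with pairwise red density at
most q / R.  Only the A-side pays the factor Δ, so the number of factors Δ lost is ⌊log q⌋ while the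
number of factors L is ⌈log q⌉; the slack between L and the bound of the theorem absorbs the
difference ⌈log q⌉ - log q.  Finally d-degeneracy lets one embed H greedily in blue, vertices of
colour j going to the j-th set.  The sets of a family are never required to be disjoint.
-}

open import Defs hiding (sym)
open import Data.Nat
  using (ℕ; zero; suc; _+_; _*_; _^_; _∸_; _≤_; _<_; z≤n; s≤s; NonZero; >-nonZero; ⌊_/2⌋; ⌈_/2⌉)
open import Data.Nat.Properties renaming (_≟_ to _≟ℕ_)
open import Data.Nat.Tactic.RingSolver using (solve-∀)
open import Algebra.Properties.Semiring.Sum +-*-semiring
  using (sum; sum-cong-≗; ∑-comm; ∑-distrib-+; *-distribˡ-sum; *-distribʳ-sum)
open import Data.Bool using (Bool; true; false; _∧_; not; if_then_else_)
import Data.Bool.Properties as Bool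
open import Data.Empty using (⊥)
open import Data.Fin
  using (Fin; zero; suc; toℕ; fromℕ<; splitAt; join; combine; remQuot; finToFun; funToFin; punchOut)
open import Data.Fin.Properties
  using (_≟_; any?; all?; toℕ-fromℕ<; toℕ<n; toℕ-injective; join-splitAt; punchOut-injective;
         <⇒notInjective; finToFun-funToFin; remQuot-combine; ¬Fin0)
open import Data.Fin.Subset using (Subset)
open import Data.Fin.Subset.Properties using (anySubset?)
open import Data.List as List using (List; length; filterᵇ)
open import Data.List.Membership.Propositional.Properties using (∈-map⁺)
open import Data.List.Properties using (length-map)
open import Data.List.Relation.Unary.Any using (index)
open import Data.List.Relation.Unary.Any.Properties using (lookup-index)
open import Data.Product using (Σ; ∃; ∃-syntax; _×_; _,_; proj₁; proj₂)
open import Data.Sum using (_⊎_; inj₁; inj₂; [_,_]′)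
import Data.Vec as Vec
open import Data.Vec.Functional using (updateAt)
open import Data.Vec.Functional.Properties using (updateAt-updates; updateAt-minimal)
open import Data.Vec.Properties using (lookup∘tabulate)
open import Function using (_∘_; id; const)
open import Function.Definitions using (Injective)
open import Relation.Binary.Definitions using (tri<; tri≈; tri>; Tri)
open import Relation.Binary.PropositionalEquality
  using (_≡_; _≢_; refl; sym; trans; cong; cong₂; subst; subst₂)
open import Relation.Nullary using (yes; no; contradiction; does; Dec; ¬_)
open import Relation.Nullary.Decidable
  using (map′; _×-dec_; _→-dec_; _⊎-dec_; ¬?; isYes≗does; ⌊_⌋; dec-false; decidable-stable; from-yes)

private variable
  m n : ℕ

-- Subsets of Fin m, their cardinality and weighted sums over them

Sub : ℕ → Set
Sub m = Fin m → Bool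

infix 4 _∋_ _⊑_
_∋_ : Sub m → Fin m → Set
p ∋ x = p x ≡ true

_⊑_ : Sub m → Sub m → Set
p ⊑ q = ∀ x → p ∋ x → q ∋ x

infixr 6 _⊓_
_⊓_ : Sub m → Sub m → Sub m
(p ⊓ q) x = p x ∧ q x

∧-true : ∀ {a b} → a ∧ b ≡ true → a ≡ true × b ≡ true
∧-true {true} {true} _ = refl , refl

∧-intro : ∀ {a b} → a ≡ true → b ≡ true → a ∧ b ≡ true
∧-intro refl refl = refl

does-true : ∀ {a} {A : Set a} (A? : Dec A) → does A? ≡ true → A
does-true (yes a) _ = a

true-does : ∀ {a} {A : Set a} (A? : Dec A) → A → does A? ≡ true
true-does (yes _) _ = refl
true-does (no ¬a) a = contradiction a ¬a

not-does-true : ∀ {a} {A : Set a} (A? : Dec A) → not (does A?) ≡ true → ¬ A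
not-does-true (no ¬a) _ = ¬a

ind : Bool → ℕ
ind true = 1
ind false = 0

ind-∧ : ∀ a b → ind (a ∧ b) ≡ ind a * ind b
ind-∧ true b = sym (+-identityʳ _)
ind-∧ false b = refl

ind-mono : ∀ {a b} → (a ≡ true → b ≡ true) → ind a ≤ ind b
ind-mono {false} _ = z≤n
ind-mono {true} h rewrite h refl = ≤-refl

♯ : Sub m → ℕ
♯ p = sum (ind ∘ p)

∑∈ : Sub m → (Fin m → ℕ) → ℕ
∑∈ p g = sum (λ x → ind (p x) * g x)

sum-mono : {f g : Fin m → ℕ} → (∀ i → f i ≤ g i) → sum f ≤ sum g
sum-mono {zero} h = z≤n
sum-mono {suc m} h = +-mono-≤ (h zero) (sum-mono (h ∘ suc))

sum-const : ∀ m c → sum {m} (λ _ → c) ≡ m * c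
sum-const zero c = refl
sum-const (suc m) c = cong (c +_) (sum-const m c)

term≤sum : (f : Fin m → ℕ) (i : Fin m) → f i ≤ sum f
term≤sum f zero = m≤m+n _ _
term≤sum f (suc i) = ≤-trans (term≤sum (f ∘ suc) i) (m≤n+m _ (f zero))

sum≡0 : (f : Fin m → ℕ) → sum f ≡ 0 → ∀ i → f i ≡ 0
sum≡0 f eq i = n≤0⇒n≡0 (subst (f i ≤_) eq (term≤sum f i))

∑∈-mono : {p q : Sub m} {f g : Fin m → ℕ} → p ⊑ q → (∀ x → p ∋ x → f x ≤ g x) → ∑∈ p f ≤ ∑∈ q g
∑∈-mono {p = p} {q} {f} {g} p⊑q f≤g = sum-mono step
  where
  step : ∀ x → ind (p x) * f x ≤ ind (q x) * g x
  step x with p x in px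
  ... | false = z≤n
  ... | true rewrite p⊑q x px = +-monoˡ-≤ 0 (f≤g x px)

∑∈-const : (p : Sub m) (c : ℕ) → ∑∈ p (λ _ → c) ≡ ♯ p * c
∑∈-const p c = sym (*-distribʳ-sum c (ind ∘ p))

∑∈-* : (p : Sub m) (c : ℕ) (g : Fin m → ℕ) → ∑∈ p (λ x → c * g x) ≡ c * ∑∈ p g
∑∈-* p c g = trans (sum-cong-≗ λ x → lemma (ind (p x)) c (g x))
  (sym (*-distribˡ-sum c (λ x → ind (p x) * g x)))
  where
  lemma : ∀ a b c → a * (b * c) ≡ b * (a * c)
  lemma = solve-∀

∑∈-bound : {p : Sub m} {f : Fin m → ℕ} (c : ℕ) → (∀ x → p ∋ x → f x ≤ c) → ∑∈ p f ≤ ♯ p * c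
∑∈-bound {p = p} c h = ≤-trans (∑∈-mono (λ _ px → px) h) (≤-reflexive (∑∈-const p c))

∑∈-+ : (p : Sub m) (f g : Fin m → ℕ) → ∑∈ p (λ x → f x + g x) ≡ ∑∈ p f + ∑∈ p g
∑∈-+ p f g =
  trans (sum-cong-≗ λ x → *-distribˡ-+ (ind (p x)) (f x) (g x))
        (∑-distrib-+ (λ x → ind (p x) * f x) (λ x → ind (p x) * g x))

∑∈-sum : (p : Sub m) (f : Fin n → Fin m → ℕ) →
  ∑∈ p (λ x → sum (λ j → f j x)) ≡ sum (λ j → ∑∈ p (f j))
∑∈-sum p f = trans (sum-cong-≗ λ x → *-distribˡ-sum (ind (p x)) (λ j → f j x))
                   (∑-comm λ x j → ind (p x) * f j x)

∑∈-ind : (p q : Sub m) → ∑∈ p (ind ∘ q) ≡ ♯ (p ⊓ q)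
∑∈-ind p q = sum-cong-≗ λ x → sym (ind-∧ (p x) (q x))

♯-mono : {p q : Sub m} → p ⊑ q → ♯ p ≤ ♯ q
♯-mono p⊑q = sum-mono λ x → ind-mono (p⊑q x)

♯-full : ∀ m → ♯ {m} (λ _ → true) ≡ m
♯-full m = trans (sum-const m 1) (*-identityʳ m)

♯-split : (p q : Sub m) → ♯ p ≡ ♯ (p ⊓ q) + ♯ (p ⊓ (not ∘ q))
♯-split p q = trans (sum-cong-≗ λ x → lemma (p x) (q x))
                      (∑-distrib-+ (ind ∘ (p ⊓ q)) (ind ∘ (p ⊓ (not ∘ q))))
  where
  lemma : ∀ a b → ind a ≡ ind (a ∧ b) + ind (a ∧ not b)
  lemma true true = refl
  lemma true false = refl
  lemma false b = refl

♯-point : (y : Fin m) → ♯ (λ x → does (x ≟ y)) ≡ 1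
♯-point {suc m} zero = cong suc (trans (sum-const m 0) (*-zeroʳ m))
♯-point (suc y) = trans (sum-cong-≗ λ x → cong ind (step x)) (♯-point y)
  where
  step : ∀ x → does (suc x ≟ suc y) ≡ does (x ≟ y)
  step x with x ≟ y
  ... | yes _ = refl
  ... | no _ = refl

♯-< : ∀ {n t} → t ≤ n → ♯ {n} (λ i → does (suc (toℕ i) ≤? t)) ≤ t
♯-< {n} {zero} _ = ≤-reflexive (trans (sum-cong-≗ {n} (λ _ → refl)) (trans (sum-const n 0) (*-zeroʳ n)))
♯-< {suc n} {suc t} (s≤s t≤n) = s≤s (♯-< t≤n)

countFin≡♯ : (p : Sub m) → countFin p ≡ ♯ p
countFin≡♯ p = go id
  where
  go : ∀ {n} (f : Fin n → Fin _) → length (filterᵇ p (List.tabulate f)) ≡ ♯ (p ∘ f)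
  go {zero} f = refl
  go {suc n} f with p (f zero)
  ... | true = cong suc (go (f ∘ suc))
  ... | false = go (f ∘ suc)

-- Otherwise every member of `p` would contribute at least 1 to the sum. The embeddings use this
-- with `g` counting the obstacles at a vertex.
exists-zero : (p : Sub m) (g : Fin m → ℕ) → ∑∈ p g < ♯ p → ∃ λ x → p ∋ x × g x ≡ 0
exists-zero p g small with any? (λ x → (p x Bool.≟ true) ×-dec (g x ≟ℕ 0))
... | yes found = found
... | no none = contradiction small (≤⇒≯ (sum-mono step))
  where
  step : ∀ x → ind (p x) ≤ ind (p x) * g x
  step x with p x in px | g x in gx
  ... | false | _ = z≤n
  ... | true | zero = contradiction (x , px , gx) none
  ... | true | suc _ = s≤s z≤n

subset-of-size : (p : Sub m) (s : ℕ) → s ≤ ♯ p → ∃ λ p′ → p′ ⊑ p × ♯ p′ ≡ s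
subset-of-size {m} p zero _ = (λ _ → false) , (λ _ ()) , trans (sum-const m 0) (*-zeroʳ m)
subset-of-size {suc m} p (suc s) s≤ with p zero in p0
... | true with subset-of-size (p ∘ suc) s (≤-pred s≤)
...   | p′ , sub , size = (λ { zero → true ; (suc x) → p′ x })
                        , (λ { zero _ → p0 ; (suc x) → sub x }) , cong suc size
subset-of-size {suc m} p (suc s) s≤ | false with subset-of-size (p ∘ suc) (suc s) s≤
...   | p′ , sub , size = (λ { zero → false ; (suc x) → p′ x })
                        , (λ { zero () ; (suc x) → sub x }) , size

-- Markov's inequality: `K` bounds the average of `g` over `p`, so at most half of `p` exceeds twice
-- that value. The factor `K` is cancelled by `1 ≤ K`.
markov : (p : Sub m) (g : Fin m → ℕ) (K : ℕ) → 1 ≤ K → ∑∈ p g ≤ ♯ p * K →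
  ♯ p ≤ 2 * ♯ (p ⊓ λ x → does (g x ≤? 2 * K))
markov p g K 1≤K h = begin
  ♯ p                ≡⟨ ♯-split p low ⟩
  l + r              ≤⟨ +-monoʳ-≤ l r≤l ⟩
  l + l              ≡⟨ cong (l +_) (+-identityʳ l) ⟨
  2 * l              ∎
  where
  open ≤-Reasoning
  low = λ x → does (g x ≤? 2 * K)
  l = ♯ (p ⊓ low)
  r = ♯ (p ⊓ (not ∘ low))
  large : ∀ x → (p ⊓ (not ∘ low)) ∋ x → 2 * K ≤ g x
  large x px = <⇒≤ (≰⇒> (not-does-true (g x ≤? 2 * K) (proj₂ (∧-true {p x} px))))
  r*2≤ : (r + r) * K ≤ (l + r) * K
  r*2≤ = begin
    (r + r) * K                      ≡⟨ lemma r K ⟩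
    r * (2 * K)                      ≡⟨ ∑∈-const (p ⊓ (not ∘ low)) (2 * K) ⟨
    ∑∈ (p ⊓ (not ∘ low)) (λ _ → 2 * K) ≤⟨ ∑∈-mono (λ x px → proj₁ (∧-true {p x} px)) large ⟩
    ∑∈ p g                           ≤⟨ h ⟩
    ♯ p * K                          ≡⟨ cong (_* K) (♯-split p low) ⟩
    (l + r) * K                      ∎
    where
    lemma : ∀ r K → (r + r) * K ≡ r * (2 * K)
    lemma = solve-∀
  r≤l : r ≤ l
  r≤l = +-cancelʳ-≤ r r l (*-cancelʳ-≤ (r + r) (l + r) K ⦃ >-nonZero 1≤K ⦄ r*2≤)

-- Greedy embeddings

infixl 9 _[_↦_]
_[_↦_] : {X : Set} → (Fin n → X) → Fin n → X → Fin n → X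
f [ i ↦ x ] = updateAt f i (const x)

module _ {X : Set} (f : Fin n → X) (i : Fin n) (x : X) where

  ↦-new : (f [ i ↦ x ]) i ≡ x
  ↦-new = updateAt-updates i f

  ↦-old : ∀ k → toℕ k < toℕ i → (f [ i ↦ x ]) k ≡ f k
  ↦-old k k<i = updateAt-minimal k i f λ { refl → <-irrefl refl k<i }

-- A partial embedding is a total function starting from arbitrary values `f₀`; `Inv t f` is meant
-- to constrain the first `t` values only, and each step overwrites one value. `Fail` lets a step
-- stop with an alternative outcome.
stepwise : {X Fail : Set} (Inv : ℕ → (Fin n → X) → Set) (f₀ : Fin n → X) → Inv 0 f₀ →
  (∀ i f → Inv (toℕ i) f → Fail ⊎ ∃ λ x → Inv (suc (toℕ i)) (f [ i ↦ x ])) →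
  Fail ⊎ ∃ λ f → Inv n f
stepwise {n} {X} {Fail} Inv f₀ inv₀ step = go n ≤-refl
  where
  go : ∀ t → t ≤ n → Fail ⊎ ∃ λ f → Inv t f
  go zero _ = inj₂ (f₀ , inv₀)
  go (suc t) t<n with go t (<⇒≤ t<n)
  ... | inj₁ fail = inj₁ fail
  ... | inj₂ (f , inv) with step (fromℕ< t<n) f (subst (λ s → Inv s f) (sym (toℕ-fromℕ< t<n)) inv)
  ...   | inj₁ fail = inj₁ fail
  ...   | inj₂ (x , inv′) = inj₂
    (f′ , subst (λ s → Inv (suc s) f′) (toℕ-fromℕ< t<n) inv′)
    where f′ = f [ fromℕ< t<n ↦ x ]

module _ {X : Set} (Q : Fin n → Fin n → X → X → Set) where

  PairsBelow : ℕ → (Fin n → X) → Set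
  PairsBelow t f = ∀ k i → toℕ k < toℕ i → toℕ i < t → Q k i (f k) (f i)

  PairsBelow-suc : ∀ i f x → PairsBelow (toℕ i) f → (∀ k → toℕ k < toℕ i → Q k i (f k) x) →
    PairsBelow (suc (toℕ i)) (f [ i ↦ x ])
  PairsBelow-suc i f x old new k j k<j (s≤s j≤i) with m≤n⇒m<n∨m≡n j≤i
  ... | inj₁ j<i = subst₂ (Q k j) (sym (↦-old f i x k (<-trans k<j j<i))) (sym (↦-old f i x j j<i))
                     (old k j k<j j<i)
  ... | inj₂ j≡i with toℕ-injective j≡i
  ...   | refl = subst₂ (Q k i) (sym (↦-old f i x k k<j)) (sym (↦-new f i x)) (new k k<j)

greedy : {X : Set} (P : Fin n → X → Set) (Q : Fin n → Fin n → X → X → Set) → (Fin n → X) →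
  (∀ i f → (∀ k → toℕ k < toℕ i → P k (f k)) →
    ∃ λ x → P i x × ∀ k → toℕ k < toℕ i → Q k i (f k) x) →
  ∃ λ f → ∀ k i → toℕ k < toℕ i → Q k i (f k) (f i)
greedy {n} {X} P Q f₀ choose with stepwise Inv f₀ ((λ _ ()) , (λ _ _ _ ())) step
  where
  Inv : ℕ → (Fin n → X) → Set
  Inv t f = (∀ k → toℕ k < t → P k (f k)) × PairsBelow Q t f
  step : ∀ i f → Inv (toℕ i) f → Data.Empty.⊥ ⊎ ∃ λ x → Inv (suc (toℕ i)) (f [ i ↦ x ])
  step i f (ps , qs) with choose i f ps
  ... | x , px , qx = inj₂ (x , ps′ , PairsBelow-suc Q i f x qs qx)
    where
    ps′ : ∀ k → toℕ k < suc (toℕ i) → P k ((f [ i ↦ x ]) k)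
    ps′ k (s≤s k≤i) with m≤n⇒m<n∨m≡n k≤i
    ... | inj₁ k<i = subst (P k) (sym (↦-old f i x k k<i)) (ps k k<i)
    ... | inj₂ k≡i with toℕ-injective k≡i
    ...   | refl = subst (P i) (sym (↦-new f i x)) px
... | inj₂ (f , _ , qs) = f , λ k i k<i → qs k i k<i (toℕ<n i)

-- Graphs whose vertices are their positions in the ordering

earlier : Graph n → Fin n → ℕ → Sub n
earlier H i t k = adj H k i ∧ does (suc (toℕ k) ≤? t)

-- A trace is compared only below `i`: its entry at `i` itself is true for every `j` adjacent to
-- `i`.
record Ordered (d Δ : ℕ) (H : Graph n) : Set where
  field
    back : ∀ i → ♯ (earlier H i (toℕ i)) ≤ d
    traces : ∀ i → ∃ λ (L : List (Sub n)) → length L ≤ Δ × (∀ j → toℕ i < toℕ j → adj H j i ≡ true →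
      ∃ λ (τ : Fin (length L)) → ∀ k → toℕ k < toℕ i → List.lookup L τ k ≡ adj H k j)

-- Only pairs in increasing order are constrained, as a greedy embedding produces them; symmetry
-- supplies the rest.
Copy : Graph n → (Fin m → Fin m → Bool) → Set
Copy {n} {m} H col = Σ (Fin n → Fin m) λ f →
  ∀ k i → toℕ k < toℕ i → f k ≢ f i × (adj H k i ≡ true → col (f k) (f i) ≡ true)

used : (Fin n → Fin m) → ℕ → Fin n → Sub m
used f t k x = does (suc (toℕ k) ≤? t) ∧ does (x ≟ f k)

∑∈-used : (p : Sub m) (f : Fin n → Fin m) (t : ℕ) → t ≤ n →
  ∑∈ p (λ x → sum λ k → ind (used f t k x)) ≤ t
∑∈-used {m} {n} p f t t≤n = begin
  ∑∈ p (λ x → sum λ k → ind (used f t k x))      ≡⟨ ∑∈-sum p (λ k x → ind (used f t k x)) ⟩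
  sum (λ k → ∑∈ p (λ x → ind (used f t k x)))    ≤⟨ sum-mono bound ⟩
  ♯ {n} (λ k → does (suc (toℕ k) ≤? t))           ≤⟨ ♯-< t≤n ⟩
  t                                               ∎
  where
  open ≤-Reasoning
  bound : ∀ k → ∑∈ p (λ x → ind (used f t k x)) ≤ ind (does (suc (toℕ k) ≤? t))
  bound k = subst (_≤ _) (sym (∑∈-ind p (used f t k))) (lemma (does (suc (toℕ k) ≤? t)))
    where
    lemma : ∀ b → ♯ (p ⊓ λ x → b ∧ does (x ≟ f k)) ≤ ind b
    lemma true = ≤-trans (♯-mono λ x px → proj₂ (∧-true {p x} px)) (≤-reflexive (♯-point (f k)))
    lemma false = ≤-trans (♯-mono {q = λ _ → false} λ x px → proj₂ (∧-true {p x} px))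
                    (≤-reflexive (trans (sum-const m 0) (*-zeroʳ m)))

ind≡0 : ∀ {b} → ind b ≡ 0 → b ≢ true
ind≡0 {false} _ ()

nonempty : (p : Sub m) → 1 ≤ ♯ p → ∃ λ x → p ∋ x
nonempty p 1≤ with exists-zero p (λ _ → 0) (subst (_< ♯ p) (sym (trans (∑∈-const p 0) (*-zeroʳ (♯ p)))) 1≤)
... | x , px , _ = x , px

-- The red embedding, whose failure yields a sparse pair

module RedEmbedding {n N d Δ : ℕ} (H : Graph n) (ordered : Ordered d Δ H)
  (red : Fin N → Sub N) (U : Sub N) (R : ℕ) ⦃ R≢0 : NonZero R ⦄ (1≤Δ : 1 ≤ Δ)
  (U-large : 2 * R ^ d * n ≤ ♯ U) where

  open Ordered ordered

  u : ℕ
  u = ♯ U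

  u-positive : Fin n → 1 ≤ u
  u-positive i = ≤-trans
    (*-mono-≤ (*-mono-≤ (s≤s (z≤n {1})) (m^n>0 R d)) (≤-trans (s≤s z≤n) (toℕ<n i))) U-large

  SparsePair : Set
  SparsePair = ∃ λ (A : Sub N) → ∃ λ (B : Sub N) → A ⊑ U × B ⊑ U ×
    u ≤ 2 * Δ * R ^ d * ♯ A × u ≤ R ^ d * ♯ B × (∀ a → A ∋ a → R * ♯ (B ⊓ red a) ≤ ♯ B)

  -- The set `S` is arbitrary rather than a neighbourhood, so that one candidate set serves all
  -- later vertices with the same trace.
  Joined : (Fin n → Fin N) → ℕ → Sub n → Fin N → Set
  Joined f t S x = ∀ k → toℕ k < t → S k ≡ true → red (f k) x ≡ true

  joined? : ∀ f t S x → Dec (Joined f t S x)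
  joined? f t S x =
    all? λ k → (suc (toℕ k) ≤? t) →-dec ((S k Bool.≟ true) →-dec (red (f k) x Bool.≟ true))

  cand : (Fin n → Fin N) → ℕ → Sub n → Sub N
  cand f t S x = U x ∧ does (joined? f t S x)

  cand-elim : ∀ f t S x → cand f t S ∋ x → U ∋ x × Joined f t S x
  cand-elim f t S x c with ∧-true {U x} c
  ... | ux , jx = ux , does-true (joined? f t S x) jx

  cand-intro : ∀ f t S x → U ∋ x → Joined f t S x → cand f t S ∋ x
  cand-intro f t S x ux jx = ∧-intro ux (true-does (joined? f t S x) jx)

  cand-⊑ : ∀ f t {S T} → (∀ k → toℕ k < t → S k ≡ T k) → cand f t S ⊑ cand f t T
  cand-⊑ f t {S} {T} S≗T x cx with cand-elim f t S x cx
  ... | ux , jx = cand-intro f t T x ux λ k k<t tk → jx k k<t (trans (S≗T k k<t) tk)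

  Nb : Fin n → Sub n
  Nb j k = adj H k j

  Compatible : Fin n → Fin n → Fin N → Fin N → Set
  Compatible k i x y = x ≢ y × (adj H k i ≡ true → red x y ≡ true)

  -- The field `large` allows one factor `R` per neighbour already placed, hence never more than
  -- `R ^ d` by degeneracy.
  record Inv (t : ℕ) (f : Fin n → Fin N) : Set where
    field
      pairs : PairsBelow Compatible t f
      large : ∀ j → t ≤ toℕ j → u ≤ R ^ ♯ (earlier H j t) * ♯ (cand f t (Nb j))
  open Inv

  earlier-≤ : ∀ j t → t ≤ toℕ j → ♯ (earlier H j t) ≤ d
  earlier-≤ j t t≤j = ≤-trans (♯-mono sub) (back j)
    where
    sub : earlier H j t ⊑ earlier H j (toℕ j)
    sub k ek with ∧-true {adj H k j} ek
    ... | a , k<t = ∧-intro a (true-does (suc (toℕ k) ≤? toℕ j) (≤-trans (does-true (suc (toℕ k) ≤? t) k<t) t≤j))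

  inv₀ : ∀ f → Inv 0 f
  inv₀ f .pairs _ _ _ ()
  inv₀ f .large j _ = ≤-trans (♯-mono λ x ux → cand-intro f 0 (Nb j) x ux λ _ ())
    (m≤n*m _ (R ^ ♯ (earlier H j 0)) ⦃ m^n≢0 R (♯ (earlier H j 0)) ⦄)

  module Step (i : Fin n) (f : Fin n → Fin N) (inv : Inv (toℕ i) f) where

    t : ℕ
    t = toℕ i

    L : List (Sub n)
    L = proj₁ (traces i)

    C : Sub N
    C = cand f t (Nb i)

    B : Fin (length L) → Sub N
    B τ = cand f t (List.lookup L τ)

    -- The size condition keeps only traces whose `B τ` can serve in a sparse pair; `L` may also
    -- hold sets that are the trace of no later neighbour of `i`.
    bad : Fin (length L) → Sub N
    bad τ x = does (u ≤? R ^ d * ♯ (B τ)) ∧ does (R * ♯ (B τ ⊓ red x) ≤? ♯ (B τ))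

    weight : Fin N → ℕ
    weight x = sum (λ k → ind (used f t k x)) + sum (λ τ → ind (bad τ x))

    C-large : u ≤ R ^ d * ♯ C
    C-large = ≤-trans (large inv i ≤-refl) (*-monoˡ-≤ (♯ C) (^-monoʳ-≤ R (earlier-≤ i t ≤-refl)))

    sparse-pair : ∀ τ → u ≤ 2 * Δ * R ^ d * ♯ (C ⊓ bad τ) → SparsePair
    -- Only membership in `bad τ` records that `B τ` is large, so one member of `C ⊓ bad τ` is
    -- needed; it exists because `u` is positive.
    sparse-pair τ u≤ with nonempty (C ⊓ bad τ) (n≢0⇒n>0 λ eq → <⇒≱ (u-positive i)
        (subst (u ≤_) (trans (cong (2 * Δ * R ^ d *_) eq) (*-zeroʳ (2 * Δ * R ^ d))) u≤))
    ... | x , cx =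
      C ⊓ bad τ , B τ
      , (λ y cy → proj₁ (cand-elim f t (Nb i) y (proj₁ (∧-true {C y} cy))))
      , (λ y cy → proj₁ (cand-elim f t (List.lookup L τ) y cy))
      , u≤
      , does-true (u ≤? R ^ d * ♯ (B τ)) (proj₁ (∧-true {does (u ≤? R ^ d * ♯ (B τ))} (proj₂ (∧-true {C x} cx))))
      , λ a ca → does-true (R * ♯ (B τ ⊓ red a) ≤? ♯ (B τ))
          (proj₂ (∧-true {does (u ≤? R ^ d * ♯ (B τ))} (proj₂ (∧-true {C a} ca))))

    -- `C` has at least `u / R ^ d` elements. Fewer than `n` are in use, which is less than half of
    -- that by `U-large`, and the at most `Δ` traces spoil at most `u / (2 Δ R ^ d)` each, together
    -- at most the other half.
    few-bad : (∀ τ → 2 * Δ * R ^ d * ♯ (C ⊓ bad τ) ≤ u) → ∑∈ C weight < ♯ C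
    few-bad h = *-cancelˡ-< (2 * R ^ d) (∑∈ C weight) (♯ C) (begin-strict
      2 * R ^ d * ∑∈ C weight            ≡⟨ cong (2 * R ^ d *_) (∑∈-+ C _ _) ⟩
      2 * R ^ d * (a + b)                ≡⟨ *-distribˡ-+ (2 * R ^ d) a b ⟩
      2 * R ^ d * a + 2 * R ^ d * b      <⟨ +-mono-<-≤ a< b≤ ⟩
      u + u                              ≤⟨ +-mono-≤ C-large C-large ⟩
      R ^ d * ♯ C + R ^ d * ♯ C          ≡⟨ lemma (R ^ d) (♯ C) ⟩
      2 * R ^ d * ♯ C                    ∎)
      where
      open ≤-Reasoning
      a = ∑∈ C (λ x → sum λ k → ind (used f t k x))
      b = ∑∈ C (λ x → sum λ τ → ind (bad τ x))
      lemma : ∀ r c → r * c + r * c ≡ 2 * r * c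
      lemma = solve-∀
      a< : 2 * R ^ d * a < u
      a< = <-≤-trans (*-monoʳ-< (2 * R ^ d) ⦃ m*n≢0 2 (R ^ d) ⦃ _ ⦄ ⦃ m^n≢0 R d ⦄ ⦄
             (≤-<-trans (∑∈-used C f t (<⇒≤ (toℕ<n i))) (toℕ<n i))) U-large
      b≤ : 2 * R ^ d * b ≤ u
      b≤ = *-cancelˡ-≤ Δ ⦃ >-nonZero 1≤Δ ⦄ (begin
        Δ * (2 * R ^ d * b)                                ≡⟨ lemma′ Δ (R ^ d) b ⟩
        2 * Δ * R ^ d * b
          ≡⟨ cong (2 * Δ * R ^ d *_) (∑∈-sum C (λ τ x → ind (bad τ x))) ⟩
        2 * Δ * R ^ d * sum (λ τ → ∑∈ C (ind ∘ bad τ))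
          ≡⟨ *-distribˡ-sum (2 * Δ * R ^ d) (λ τ → ∑∈ C (ind ∘ bad τ)) ⟩
        sum (λ τ → 2 * Δ * R ^ d * ∑∈ C (ind ∘ bad τ))
          ≤⟨ sum-mono (λ τ → subst (λ s → 2 * Δ * R ^ d * s ≤ u) (sym (∑∈-ind C (bad τ))) (h τ)) ⟩
        sum {length L} (λ _ → u)                           ≡⟨ sum-const (length L) u ⟩
        length L * u
          ≤⟨ *-monoˡ-≤ u (proj₁ (proj₂ (traces i))) ⟩
        Δ * u                                              ∎)
        where
        lemma′ : ∀ x r c → x * (2 * r * c) ≡ 2 * x * r * c
        lemma′ = solve-∀

    extend : ∀ v → C ∋ v → weight v ≡ 0 → Inv (suc t) (f [ i ↦ v ])
    extend v cv w≡0 = record { pairs = PairsBelow-suc Compatible i f v (pairs inv) new ; large = large′ }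
      where
      f′ = f [ i ↦ v ]
      new : ∀ k → toℕ k < toℕ i → Compatible k i (f k) v
      new k k<i = (λ { refl → ind≡0 (sum≡0 _ (m+n≡0⇒m≡0 _ w≡0) k)
                       (∧-intro (true-does (suc (toℕ k) ≤? t) k<i) (true-does (f k ≟ f k) refl)) })
                , proj₂ (cand-elim f t (Nb i) v cv) k k<i
      joined′ : ∀ j x → Joined f t (Nb j) x → (adj H i j ≡ true → red v x ≡ true) →
        Joined f′ (suc t) (Nb j) x
      joined′ j x jx vx k (s≤s k≤i) kj with m≤n⇒m<n∨m≡n k≤i
      ... | inj₁ k<i = subst (λ y → red y x ≡ true) (sym (↦-old f i v k k<i)) (jx k k<i kj)
      ... | inj₂ k≡i with toℕ-injective k≡i
      ...   | refl = subst (λ y → red y x ≡ true) (sym (↦-new f i v)) (vx kj)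
      later-⊑ : ∀ j → earlier H j t ⊑ earlier H j (suc t)
      later-⊑ j k ek with ∧-true {adj H k j} ek
      ... | a , k<t = ∧-intro a
        (true-does (suc (toℕ k) ≤? suc t) (m≤n⇒m≤1+n (does-true (suc (toℕ k) ≤? t) k<t)))
      -- The vertex `i` is a new earlier neighbour of `j`, which pays for the factor `R` lost in
      -- this step.
      earlier-suc : ∀ j → adj H i j ≡ true → suc (♯ (earlier H j t)) ≤ ♯ (earlier H j (suc t))
      earlier-suc j ij = begin
        suc (♯ (earlier H j t))                       ≡⟨ cong (_+ ♯ (earlier H j t)) (♯-point i) ⟨
        ♯ point + ♯ (earlier H j t)                   ≤⟨ +-mono-≤ (♯-mono at-i) (♯-mono off-i) ⟩
        ♯ (p ⊓ point) + ♯ (p ⊓ (not ∘ point))         ≡⟨ ♯-split p point ⟨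
        ♯ p                                           ∎
        where
        open ≤-Reasoning
        p = earlier H j (suc t)
        point : Sub n
        point k = does (k ≟ i)
        at-i : point ⊑ (p ⊓ point)
        at-i k k≡i with does-true (k ≟ i) k≡i
        ... | refl = ∧-intro (∧-intro ij (true-does (suc t ≤? suc t) ≤-refl)) k≡i
        off-i : earlier H j t ⊑ (p ⊓ (not ∘ point))
        off-i k ek = ∧-intro (later-⊑ j k ek) (cong not (dec-false (k ≟ i) λ { refl →
          <-irrefl refl (does-true (suc (toℕ k) ≤? t) (proj₂ (∧-true {adj H k j} ek))) }))
      large′ : ∀ j → suc t ≤ toℕ j → u ≤ R ^ ♯ (earlier H j (suc t)) * ♯ (cand f′ (suc t) (Nb j))
      large′ j i<j with adj H i j in ij
      ... | false = ≤-trans (large inv j (<⇒≤ i<j))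
        (*-mono-≤ (^-monoʳ-≤ R (♯-mono (later-⊑ j))) (♯-mono λ x cx → let ux , jx = cand-elim f t (Nb j) x cx in
          cand-intro f′ (suc t) (Nb j) x ux (joined′ j x jx λ h → contradiction (trans (sym ij) h) λ ())))
      -- The candidates of `j` are those of its trace, the set `B τ`; since `v` is not bad for `τ`,
      -- more than a `1 / R` share of them is red-adjacent to `v`.
      ... | true with proj₂ (proj₂ (traces i)) j i<j (trans (Graph.sym H j i) ij)
      ...   | τ , τ≗ = begin
        u                                                   ≤⟨ large inv j (<⇒≤ i<j) ⟩
        R ^ e * ♯ (cand f t (Nb j))                         ≤⟨ *-monoʳ-≤ (R ^ e) to-B ⟩
        R ^ e * ♯ (B τ)
          ≤⟨ *-monoʳ-≤ (R ^ e) (<⇒≤ (≰⇒> not-bad)) ⟩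
        R ^ e * (R * ♯ (B τ ⊓ red v))                       ≡⟨ lemma (R ^ e) R (♯ (B τ ⊓ red v)) ⟩
        R ^ suc e * ♯ (B τ ⊓ red v)
          ≤⟨ *-mono-≤ (^-monoʳ-≤ R (earlier-suc j ij)) (♯-mono next) ⟩
        R ^ ♯ (earlier H j (suc t)) * ♯ (cand f′ (suc t) (Nb j)) ∎
        where
        open ≤-Reasoning
        e = ♯ (earlier H j t)
        lemma : ∀ a r b → a * (r * b) ≡ r * a * b
        lemma = solve-∀
        to-B : ♯ (cand f t (Nb j)) ≤ ♯ (B τ)
        to-B = ♯-mono (cand-⊑ f t λ k k<t → sym (τ≗ k k<t))
        B-large : u ≤ R ^ d * ♯ (B τ)
        B-large = ≤-trans (large inv j (<⇒≤ i<j)) (*-mono-≤ (^-monoʳ-≤ R (earlier-≤ j t (<⇒≤ i<j))) to-B)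
        not-bad : ¬ R * ♯ (B τ ⊓ red v) ≤ ♯ (B τ)
        not-bad few = ind≡0 (sum≡0 _ (m+n≡0⇒n≡0 (sum (λ k → ind (used f t k v))) w≡0) τ)
          (∧-intro (true-does (u ≤? R ^ d * ♯ (B τ)) B-large) (true-does (R * ♯ (B τ ⊓ red v) ≤? ♯ (B τ)) few))
        next : (B τ ⊓ red v) ⊑ cand f′ (suc t) (Nb j)
        next x bx with ∧-true {B τ x} bx
        ... | cx , vx with cand-elim f t (Nb j) x (cand-⊑ f t τ≗ x cx)
        ...   | ux , jx = cand-intro f′ (suc t) (Nb j) x ux (joined′ j x jx λ _ → vx)

    step : SparsePair ⊎ ∃ λ v → Inv (suc t) (f [ i ↦ v ])
    step with any? (λ τ → u ≤? 2 * Δ * R ^ d * ♯ (C ⊓ bad τ))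
    ... | yes (τ , u≤) = inj₁ (sparse-pair τ u≤)
    ... | no none with exists-zero C weight (few-bad λ τ → <⇒≤ (≰⇒> λ u≤ → none (τ , u≤)))
    ...   | v , cv , w≡0 = inj₂ (v , extend v cv w≡0)

  red-copy-or-sparse-pair : SparsePair ⊎ Copy H red
  red-copy-or-sparse-pair with stepwise Inv f₀ (inv₀ f₀) (Step.step)
    where
    f₀ : Fin n → Fin N
    f₀ i = proj₁ (nonempty U (u-positive i))
  ... | inj₁ sparse = inj₁ sparse
  ... | inj₂ (f , inv) = inj₂ (f , λ k i k<i → pairs inv k i k<i (toℕ<n i))

-- Families of sets with few red edges between them

half-≤ : ∀ {q a} → q ≤ 2 * a → ⌈ q /2⌉ ≤ a
half-≤ {q} {a} q≤ = subst (⌈ q /2⌉ ≤_) (sym (n≡⌈n+n/2⌉ a))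
  (⌈n/2⌉-mono (subst (q ≤_) (cong (a +_) (+-identityʳ a)) q≤))

half-< : ∀ {q a} → q < 2 * a → ⌊ q /2⌋ < a
half-< {q} {a} q< = ≰⇒> λ a≤ → <⇒≱ q< (begin
  2 * a                  ≡⟨ cong (a +_) (+-identityʳ a) ⟩
  a + a                  ≤⟨ +-mono-≤ a≤ (≤-trans a≤ (⌊n/2⌋≤⌈n/2⌉ q)) ⟩
  ⌊ q /2⌋ + ⌈ q /2⌉      ≡⟨ ⌊n/2⌋+⌈n/2⌉≡n q ⟩
  q                      ∎)
  where open ≤-Reasoning

module _ {N : ℕ} (red : Fin N → Sub N) (red-sym : ∀ x y → red x y ≡ red y x) where

  -- Ordered pairs are counted, so that `A` and `B` may overlap.
  edges : Sub N → Sub N → ℕ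
  edges A B = ∑∈ A (λ x → ♯ (B ⊓ red x))

  edges-sym : ∀ A B → edges A B ≡ edges B A
  edges-sym A B = trans (expand A B) (trans (∑-comm (term A B))
    (trans (sum-cong-≗ λ y → sum-cong-≗ λ x → swap x y) (sym (expand B A))))
    where
    term : Sub N → Sub N → Fin N → Fin N → ℕ
    term A B x y = ind (A x) * ind ((B ⊓ red x) y)
    expand : ∀ A B → edges A B ≡ sum (λ x → sum (term A B x))
    expand A B = sum-cong-≗ λ x → *-distribˡ-sum (ind (A x)) (ind ∘ (B ⊓ red x))
    swap : ∀ x y → term A B x y ≡ term B A y x
    swap x y rewrite red-sym x y | ind-∧ (B y) (red y x) | ind-∧ (A x) (red y x) =
      lemma (ind (A x)) (ind (B y)) (ind (red y x))
      where
      lemma : ∀ a b c → a * (b * c) ≡ b * (a * c)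
      lemma = solve-∀

module Families {n N d Δ : ℕ} (H : Graph n) (ordered : Ordered d Δ H)
  (red : Fin N → Sub N) (red-sym : ∀ x y → red x y ≡ red y x)
  (R : ℕ) ⦃ R≢0 : NonZero R ⦄ (1≤Δ : 1 ≤ Δ) (s : ℕ) (1≤s : 1 ≤ s) (n≤s : n ≤ s) where

  e : Sub N → Sub N → ℕ
  e = edges red red-sym

  L : ℕ
  L = 2 * R ^ d

  -- The last condition bounds the red density between two members by `q / R`; the `q` in the
  -- numerator lets the density grow as families are merged.
  Family : ℕ → Sub N → Set
  Family q U = ∃ λ (W : Fin q → Sub N) → (∀ i → W i ⊑ U × ♯ (W i) ≡ s) ×
    (∀ i j → i ≢ j → R * e (W i) (W j) ≤ q * (s * s))

  -- `M` is the price of `q` sets in units of `s`; the recursion below only manipulates these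
  -- prices.
  Good : ℕ → ℕ → Set
  Good q M = ∀ U → M * s ≤ ♯ U → Family q U ⊎ Copy H red

  good-mono : ∀ {q M M′} → M ≤ M′ → Good q M → Good q M′
  good-mono M≤M′ good U U-large = good U (≤-trans (*-monoˡ-≤ s M≤M′) U-large)

  good-one : Good 1 1
  good-one U U-large with subset-of-size U s (subst (_≤ ♯ U) (+-identityʳ s) U-large)
  ... | W , W⊑U , size = inj₁ ((λ _ → W) , (λ _ → W⊑U , size) ,
    λ { zero zero i≢j → contradiction refl i≢j })

  -- One splitting step: the smaller family goes into `A`, where a factor `Δ` is lost, and the
  -- larger one into the part of `B` that sees the first sparsely.
  module Combine {q₁ q₂ M₁ M₂ M : ℕ} (1≤q₁ : 1 ≤ q₁) (q₁≤q₂ : q₁ ≤ q₂)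
    (good₁ : Good q₁ M₁) (good₂ : Good q₂ M₂)
    (M₁≤ : L * Δ * M₁ ≤ M) (M₂≤ : L * M₂ ≤ M) (L≤M : L ≤ M)
    (U : Sub N) (U-large : M * s ≤ ♯ U) where

    open ≤-Reasoning

    instance
      L≢0 : NonZero L
      L≢0 = m*n≢0 2 (R ^ d) ⦃ _ ⦄ ⦃ m^n≢0 R d ⦄

    A-large : ∀ {a} → ♯ U ≤ 2 * Δ * R ^ d * a → M₁ * s ≤ a
    A-large {a} u≤ = *-cancelˡ-≤ (L * Δ) ⦃ m*n≢0 L Δ ⦃ L≢0 ⦄ ⦃ >-nonZero 1≤Δ ⦄ ⦄ (begin
      L * Δ * (M₁ * s)        ≡⟨ *-assoc (L * Δ) M₁ s ⟨
      L * Δ * M₁ * s          ≤⟨ *-monoˡ-≤ s M₁≤ ⟩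
      M * s                   ≤⟨ U-large ⟩
      ♯ U                     ≤⟨ u≤ ⟩
      2 * Δ * R ^ d * a     ≡⟨ lemma Δ (R ^ d) a ⟩
      L * Δ * a             ∎)
      where
      lemma : ∀ x r a → 2 * x * r * a ≡ 2 * r * x * a
      lemma = solve-∀

    module Low (B : Sub N) (W : Fin q₁ → Sub N) (size : ∀ i → ♯ (W i) ≡ s) where

      g : Fin N → ℕ
      g b = R * sum (λ i → ♯ (W i ⊓ red b))

      low : Sub N
      low = B ⊓ λ b → does (g b ≤? 2 * (q₁ * s))

      -- Double counting: by symmetry of `red` the sum over `B` is taken from the side of the `W i`,
      -- where each vertex has few red neighbours in `B`.
      sparse : (∀ i a → W i ∋ a → R * ♯ (B ⊓ red a) ≤ ♯ B) → ∑∈ B g ≤ ♯ B * (q₁ * s)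
      sparse few = begin
        ∑∈ B g                                   ≡⟨ ∑∈-* B R (λ b → sum λ i → ♯ (W i ⊓ red b)) ⟩
        R * ∑∈ B (λ b → sum λ i → ♯ (W i ⊓ red b))
          ≡⟨ cong (R *_) (∑∈-sum B (λ i b → ♯ (W i ⊓ red b))) ⟩
        R * sum (λ i → e B (W i))                ≡⟨ *-distribˡ-sum R (λ i → e B (W i)) ⟩
        sum (λ i → R * e B (W i))                ≤⟨ sum-mono bound ⟩
        sum {q₁} (λ _ → s * ♯ B)                 ≡⟨ sum-const q₁ (s * ♯ B) ⟩
        q₁ * (s * ♯ B)                           ≡⟨ lemma q₁ s (♯ B) ⟩
        ♯ B * (q₁ * s)                           ∎
        where
        lemma : ∀ a b c → a * (b * c) ≡ c * (a * b)
        lemma = solve-∀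
        bound : ∀ i → R * e B (W i) ≤ s * ♯ B
        bound i = begin
          R * e B (W i)                          ≡⟨ cong (R *_) (edges-sym red red-sym B (W i)) ⟩
          R * e (W i) B                          ≡⟨ ∑∈-* (W i) R (λ a → ♯ (B ⊓ red a)) ⟨
          ∑∈ (W i) (λ a → R * ♯ (B ⊓ red a))     ≤⟨ ∑∈-bound (♯ B) (few i) ⟩
          ♯ (W i) * ♯ B                          ≡⟨ cong (_* ♯ B) (size i) ⟩
          s * ♯ B                                ∎

      -- Discarding up to half of `B` costs the factor 2 that turns `R ^ d` into `L`.
      low-large : (∀ i a → W i ∋ a → R * ♯ (B ⊓ red a) ≤ ♯ B) → ♯ U ≤ R ^ d * ♯ B → M₂ * s ≤ ♯ low
      low-large few u≤ = *-cancelˡ-≤ L (begin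
        L * (M₂ * s)           ≡⟨ *-assoc L M₂ s ⟨
        L * M₂ * s             ≤⟨ *-monoˡ-≤ s M₂≤ ⟩
        M * s                  ≤⟨ U-large ⟩
        ♯ U                    ≤⟨ u≤ ⟩
        R ^ d * ♯ B
          ≤⟨ *-monoʳ-≤ (R ^ d) (markov B g (q₁ * s) (*-mono-≤ 1≤q₁ 1≤s) (sparse few)) ⟩
        R ^ d * (2 * ♯ low)    ≡⟨ lemma (R ^ d) (♯ low) ⟩
        L * ♯ low              ∎)
        where
        lemma : ∀ r a → r * (2 * a) ≡ 2 * r * a
        lemma = solve-∀

      cross : ∀ V → V ⊑ low → ♯ V ≡ s → ∀ i → R * e V (W i) ≤ (q₁ + q₂) * (s * s)
      cross V V⊑low size-V i = begin
        R * e V (W i)                            ≡⟨ ∑∈-* V R (λ b → ♯ (W i ⊓ red b)) ⟨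
        ∑∈ V (λ b → R * ♯ (W i ⊓ red b))         ≤⟨ ∑∈-bound (2 * (q₁ * s)) bound ⟩
        ♯ V * (2 * (q₁ * s))                     ≡⟨ cong (_* (2 * (q₁ * s))) size-V ⟩
        s * (2 * (q₁ * s))                       ≡⟨ lemma q₁ s ⟩
        -- The doubling from Markov's inequality is absorbed by `q₁ ≤ q₂`.
        (q₁ + q₁) * (s * s)                      ≤⟨ *-monoˡ-≤ (s * s) (+-monoʳ-≤ q₁ q₁≤q₂) ⟩
        (q₁ + q₂) * (s * s)                      ∎
        where
        lemma : ∀ q s → s * (2 * (q * s)) ≡ (q + q) * (s * s)
        lemma = solve-∀
        bound : ∀ b → V ∋ b → R * ♯ (W i ⊓ red b) ≤ 2 * (q₁ * s)
        bound b vb = ≤-trans (*-monoʳ-≤ R (term≤sum (λ i → ♯ (W i ⊓ red b)) i))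
          (does-true (g b ≤? 2 * (q₁ * s)) (proj₂ (∧-true {B b} (V⊑low b vb))))

    -- The type is dependent because the second family lives in the vertices of `B` with few red
    -- neighbours in the sets of the first.
    glue : (A B : Sub N) → A ⊑ U → B ⊑ U → (∀ a → A ∋ a → R * ♯ (B ⊓ red a) ≤ ♯ B) →
      (F₁ : Family q₁ A) → (let open Low B (proj₁ F₁) (λ i → proj₂ (proj₁ (proj₂ F₁) i))) →
      Family q₂ low → Family (q₁ + q₂) U
    glue A B A⊑U B⊑U few (W , inA , sparseW) (V , inB , sparseV) =
      (λ i → part (splitAt q₁ i)) , (λ i → inside (splitAt q₁ i)) ,
      λ i j i≢j → apart (splitAt q₁ i) (splitAt q₁ j)
        (λ eq → i≢j (trans (sym (join-splitAt q₁ q₂ i)) (trans (cong (join q₁ q₂) eq) (join-splitAt q₁ q₂ j))))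
      where
      open Low B W (λ i → proj₂ (inA i))
      part : Fin q₁ ⊎ Fin q₂ → Sub N
      part = [ W , V ]′
      inside : ∀ c → part c ⊑ U × ♯ (part c) ≡ s
      inside (inj₁ i) = (λ x wx → A⊑U x (proj₁ (inA i) x wx)) , proj₂ (inA i)
      inside (inj₂ j) = (λ x vx → B⊑U x (proj₁ (∧-true {B x} (proj₁ (inB j) x vx)))) , proj₂ (inB j)
      apart : ∀ c c′ → c ≢ c′ → R * e (part c) (part c′) ≤ (q₁ + q₂) * (s * s)
      apart (inj₁ i) (inj₁ j) i≢j =
        ≤-trans (sparseW i j (i≢j ∘ cong inj₁)) (*-monoˡ-≤ (s * s) (m≤m+n q₁ q₂))
      apart (inj₂ i) (inj₂ j) i≢j =
        ≤-trans (sparseV i j (i≢j ∘ cong inj₂)) (*-monoˡ-≤ (s * s) (m≤n+m q₂ q₁))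
      apart (inj₂ j) (inj₁ i) _ = cross (V j) (proj₁ (inB j)) (proj₂ (inB j)) i
      apart (inj₁ i) (inj₂ j) _ = subst (λ k → R * k ≤ (q₁ + q₂) * (s * s))
        (edges-sym red red-sym (V j) (W i)) (cross (V j) (proj₁ (inB j)) (proj₂ (inB j)) i)

    family : Family (q₁ + q₂) U ⊎ Copy H red
    family with RedEmbedding.red-copy-or-sparse-pair H ordered red U R 1≤Δ
                  (≤-trans (*-mono-≤ L≤M n≤s) U-large)
    ... | inj₂ copy = inj₂ copy
    ... | inj₁ (A , B , A⊑U , B⊑U , uA , uB , few) with good₁ A (A-large uA)
    ...   | inj₂ copy = inj₂ copy
    ...   | inj₁ F₁@(W , inA , _) with good₂ (Low.low B W (proj₂ ∘ inA))
              (Low.low-large B W (proj₂ ∘ inA) (λ i a wa → few a (proj₁ (inA i) a wa)) uB)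
    ...     | inj₂ copy = inj₂ copy
    ...     | inj₁ F₂ = inj₁ (glue A B A⊑U B⊑U few F₁ F₂)

  good-halves : ∀ {q M₁ M₂ M} → 2 ≤ q → Good ⌊ q /2⌋ M₁ → Good ⌈ q /2⌉ M₂ →
    L * Δ * M₁ ≤ M → L * M₂ ≤ M → L ≤ M → Good q M
  good-halves {q} {M = M} 2≤q good₁ good₂ M₁≤ M₂≤ L≤M = subst (λ q → Good q M) (⌊n/2⌋+⌈n/2⌉≡n q)
    (Combine.family (⌊n/2⌋-mono 2≤q) (⌊n/2⌋≤⌈n/2⌉ q) good₁ good₂ M₁≤ M₂≤ L≤M)

  1≤L : 1 ≤ L
  1≤L = *-mono-≤ (s≤s (z≤n {1})) (m^n>0 R d)

  1≤LΔ^ : ∀ k → 1 ≤ (L * Δ) ^ k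
  1≤LΔ^ k = m^n>0 (L * Δ) ⦃ >-nonZero (*-mono-≤ 1≤L 1≤Δ) ⦄ k

  L≤LΔ : L ≤ L * Δ
  L≤LΔ = m≤m*n L Δ ⦃ >-nonZero 1≤Δ ⦄

  -- Halving `q ≤ 2 ^ suc k` leaves both halves at most `2 ^ k`; each level multiplies the price by
  -- `L * Δ`, enough for either side of the split.
  good-power : ∀ k q → 1 ≤ q → q ≤ 2 ^ k → Good q ((L * Δ) ^ k)
  good-power k 1 _ _ = good-mono (1≤LΔ^ k) good-one
  good-power zero (suc (suc q)) _ (s≤s ())
  good-power (suc k) q@(suc (suc _)) _ q≤ = good-halves (s≤s (s≤s z≤n))
    (good-power k ⌊ q /2⌋ (s≤s z≤n) (≤-trans (⌊n/2⌋≤⌈n/2⌉ q) (half-≤ q≤)))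
    (good-power k ⌈ q /2⌉ (s≤s z≤n) (half-≤ q≤))
    ≤-refl (*-monoˡ-≤ ((L * Δ) ^ k) L≤LΔ)
    (≤-trans L≤LΔ (m≤m*n (L * Δ) ((L * Δ) ^ k) ⦃ >-nonZero (1≤LΔ^ k) ⦄))

  -- Only the A-side of a split costs a factor Δ, and of 2 ^ (1 + k) leaves just one is reached by A-sides alone.
  good-nonpower : ∀ k q → 1 ≤ q → q < 2 ^ suc k → Good q (L * (L * Δ) ^ k)
  good-nonpower k 1 _ _ = good-mono (*-mono-≤ 1≤L (1≤LΔ^ k)) good-one
  good-nonpower zero (suc (suc q)) _ (s≤s (s≤s ()))
  good-nonpower (suc k) q@(suc (suc _)) _ q< = good-halves (s≤s (s≤s z≤n))
    (good-nonpower k ⌊ q /2⌋ (s≤s z≤n) (half-< q<))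
    -- The B-side is charged only `L`, so it can afford a full `Δ` per level; the strict inequality
    -- is passed to the A-side alone.
    (good-power (suc k) ⌈ q /2⌉ (s≤s z≤n) (half-≤ (<⇒≤ q<)))
    (≤-reflexive (lemma (L * Δ) L ((L * Δ) ^ k))) ≤-refl
    (m≤m*n L ((L * Δ) ^ suc k) ⦃ >-nonZero (1≤LΔ^ (suc k)) ⦄)
    where
    lemma : ∀ a b c → a * (b * c) ≡ b * (a * c)
    lemma = solve-∀

-- The blue embedding

module BlueEmbedding {n N d q : ℕ} (H : Graph n) (back : ∀ i → ♯ (earlier H i (toℕ i)) ≤ d)
  (c : Fin n → Fin q) (proper : ∀ k i → adj H k i ≡ true → c k ≢ c i)
  (red : Fin N → Sub N) (1≤d : 1 ≤ d) (1≤n : 1 ≤ n) (1≤q : 1 ≤ q)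
  (W : Fin q → Sub N) (size : ∀ i → ♯ (W i) ≡ 4 * n)
  (sparse : ∀ i j → i ≢ j →
    8 * d * (q * q) * ∑∈ (W i) (λ x → ♯ (W j ⊓ red x)) ≤ q * (4 * n * (4 * n))) where

  open ≤-Reasoning

  s R K : ℕ
  s = 4 * n
  R = 8 * d * (q * q)
  K = q * (q * s)

  -- Red edges inside `W i` count as zero: `sparse` does not bound them, and adjacent vertices of
  -- `H` never share a colour.
  degree : Fin q → Fin q → Fin N → ℕ
  degree i j x = if does (i ≟ j) then 0 else ♯ (W j ⊓ red x)

  g : Fin q → Fin N → ℕ
  g i x = R * sum (λ j → degree i j x)

  clean : Fin q → Sub N
  clean i = W i ⊓ λ x → does (g i x ≤? 2 * K)

  -- The bound `sparse`, summed over the `q` sets, makes `K` an upper bound for the average of `g i`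
  -- on `W i`; Markov's inequality keeps half of the `4 * n` vertices.
  clean-large : ∀ i → 2 * n ≤ ♯ (clean i)
  clean-large i = *-cancelˡ-≤ 2 (begin
    2 * (2 * n)        ≡⟨ *-assoc 2 2 n ⟨
    s                  ≡⟨ size i ⟨
    ♯ (W i)
      ≤⟨ markov (W i) (g i) K (*-mono-≤ 1≤q (*-mono-≤ 1≤q (*-mono-≤ (s≤s (z≤n {3})) 1≤n))) total ⟩
    2 * ♯ (clean i)    ∎)
    where
    bound : ∀ j → R * ∑∈ (W i) (degree i j) ≤ q * (s * s)
    bound j with i ≟ j
    ... | no i≢j = sparse i j i≢j
    ... | yes _ = ≤-trans (≤-reflexive
      (trans (cong (R *_) (trans (∑∈-const (W i) 0) (*-zeroʳ (♯ (W i))))) (*-zeroʳ R))) z≤n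
    total : ∑∈ (W i) (g i) ≤ ♯ (W i) * K
    total = begin
      ∑∈ (W i) (g i)
        ≡⟨ ∑∈-* (W i) R (λ x → sum λ j → degree i j x) ⟩
      R * ∑∈ (W i) (λ x → sum λ j → degree i j x)      ≡⟨ cong (R *_) (∑∈-sum (W i) (degree i)) ⟩
      R * sum (λ j → ∑∈ (W i) (degree i j))
        ≡⟨ *-distribˡ-sum R (λ j → ∑∈ (W i) (degree i j)) ⟩
      sum (λ j → R * ∑∈ (W i) (degree i j))            ≤⟨ sum-mono bound ⟩
      sum {q} (λ _ → q * (s * s))                      ≡⟨ sum-const q (q * (s * s)) ⟩
      q * (q * (s * s))                                ≡⟨ lemma q s ⟩
      s * K                                            ≡⟨ cong (_* K) (size i) ⟨
      ♯ (W i) * K                                      ∎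
      where
      lemma : ∀ q s → q * (q * (s * s)) ≡ s * (q * (q * s))
      lemma = solve-∀

  -- The constants are fixed here: `2 * K` equals `8 q² n` and `R` equals `8 d q²`, so a clean
  -- vertex has at most `n / d` red neighbours in any other set.
  clean-sparse : ∀ i j x → i ≢ j → clean i ∋ x → d * ♯ (W j ⊓ red x) ≤ n
  clean-sparse i j x i≢j cx = *-cancelˡ-≤ (8 * (q * q)) ⦃ m*n≢0 8 (q * q) ⦃ _ ⦄ ⦃ >-nonZero (*-mono-≤ 1≤q 1≤q) ⦄ ⦄ (begin
    8 * (q * q) * (d * ♯ (W j ⊓ red x))   ≡⟨ lemma q d (♯ (W j ⊓ red x)) ⟩
    R * ♯ (W j ⊓ red x)                   ≡⟨ cong (R *_) deg ⟨
    R * degree i j x                      ≤⟨ *-monoʳ-≤ R (term≤sum (λ j → degree i j x) j) ⟩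
    g i x
      ≤⟨ does-true (g i x ≤? 2 * K) (proj₂ (∧-true {W i x} cx)) ⟩
    2 * K                                 ≡⟨ lemma′ q n ⟩
    8 * (q * q) * n                       ∎)
    where
    deg : degree i j x ≡ ♯ (W j ⊓ red x)
    deg rewrite dec-false (i ≟ j) i≢j = refl
    lemma : ∀ q d a → 8 * (q * q) * (d * a) ≡ 8 * d * (q * q) * a
    lemma = solve-∀
    lemma′ : ∀ q n → 2 * (q * (q * (4 * n))) ≡ 8 * (q * q) * n
    lemma′ = solve-∀

  module Choose (i : Fin n) (f : Fin n → Fin N)
    (placed : ∀ k → toℕ k < toℕ i → clean (c k) ∋ f k) where

    t : ℕ
    t = toℕ i

    p : Sub N
    p = clean (c i)

    blocked : Fin n → Sub N
    blocked k x = earlier H i t k ∧ red (f k) x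

    weight : Fin N → ℕ
    weight x = sum (λ k → ind (used f t k x)) + sum (λ k → ind (blocked k x))

    few-blocked : ∀ k → d * ♯ (p ⊓ blocked k) ≤ ind (earlier H i t k) * n
    few-blocked k with earlier H i t k in ek
    ... | false = ≤-reflexive (trans (cong (d *_) (n≤0⇒n≡0 (≤-trans
        (♯-mono {q = λ _ → false} λ x px → proj₂ (∧-true {p x} px))
        (≤-reflexive (trans (sum-const N 0) (*-zeroʳ N)))))) (*-zeroʳ d))
    ... | true with ∧-true {adj H k i} ek
    ...   | ki , k<i = begin
      d * ♯ (p ⊓ red (f k))
        ≤⟨ *-monoʳ-≤ d (♯-mono {p = p ⊓ red (f k)} {q = W (c i) ⊓ red (f k)} λ x px →
                                            let cx , rx = ∧-true {p x} px in ∧-intro (proj₁ (∧-true {W (c i) x} cx)) rx) ⟩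
      d * ♯ (W (c i) ⊓ red (f k))
        ≤⟨ clean-sparse (c k) (c i) (f k) (proper k i ki) (placed k (does-true (suc (toℕ k) ≤? t) k<i)) ⟩
      n                                ≡⟨ *-identityˡ n ⟨
      1 * n                            ∎

    -- Of at least `2 n` clean vertices, fewer than `n` are in use, and at most `d` placed
    -- neighbours block at most `n / d` each.
    small : ∑∈ p weight < ♯ p
    small = begin-strict
      ∑∈ p weight      ≡⟨ ∑∈-+ p _ _ ⟩
      a + b            <⟨ +-mono-<-≤ (≤-<-trans (∑∈-used p f t (<⇒≤ (toℕ<n i))) (toℕ<n i)) b≤n ⟩
      n + n            ≡⟨ cong (n +_) (+-identityʳ n) ⟨
      2 * n            ≤⟨ clean-large (c i) ⟩
      ♯ p              ∎
      where
      a = ∑∈ p (λ x → sum λ k → ind (used f t k x))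
      b = ∑∈ p (λ x → sum λ k → ind (blocked k x))
      b≤n : b ≤ n
      b≤n = *-cancelˡ-≤ d ⦃ >-nonZero 1≤d ⦄ (begin
        d * b
          ≡⟨ cong (d *_) (∑∈-sum p (λ k x → ind (blocked k x))) ⟩
        d * sum (λ k → ∑∈ p (ind ∘ blocked k))
          ≡⟨ cong (d *_) (sum-cong-≗ λ k → ∑∈-ind p (blocked k)) ⟩
        d * sum (λ k → ♯ (p ⊓ blocked k))
          ≡⟨ *-distribˡ-sum d (λ k → ♯ (p ⊓ blocked k)) ⟩
        sum (λ k → d * ♯ (p ⊓ blocked k))              ≤⟨ sum-mono few-blocked ⟩
        sum (λ k → ind (earlier H i t k) * n)          ≡⟨ *-distribʳ-sum n (ind ∘ earlier H i t) ⟨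
        ♯ (earlier H i t) * n                          ≤⟨ *-monoˡ-≤ n (back i) ⟩
        d * n                                          ∎)

    choice : ∃ λ x → clean (c i) ∋ x ×
      (∀ k → toℕ k < toℕ i → f k ≢ x × (adj H k i ≡ true → not (red (f k) x) ≡ true))
    choice with exists-zero p weight small
    ... | x , px , w≡0 = x , px , λ k k<i →
      let k<i′ = true-does (suc (toℕ k) ≤? t) k<i in
      (λ { refl → ind≡0 (sum≡0 _ (m+n≡0⇒m≡0 _ w≡0) k) (∧-intro k<i′ (true-does (f k ≟ f k) refl)) }) ,
      λ ki → ≢true⇒not (λ r → ind≡0 (sum≡0 _ (m+n≡0⇒n≡0 (sum (λ k → ind (used f t k x))) w≡0) k)
               (∧-intro (∧-intro ki k<i′) r))
      where
      ≢true⇒not : ∀ {b} → b ≢ true → not b ≡ true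
      ≢true⇒not {true} b≢ = contradiction refl b≢
      ≢true⇒not {false} _ = refl

  blue-copy : Copy H (λ x y → not (red x y))
  blue-copy = greedy (λ i x → clean (c i) ∋ x)
    (λ k i x y → x ≢ y × (adj H k i ≡ true → not (red x y) ≡ true)) f₀ Choose.choice
    where
    f₀ : Fin n → Fin N
    f₀ i = proj₁ (nonempty (clean (c i)) (≤-trans (*-mono-≤ (s≤s (z≤n {1})) 1≤n) (clean-large (c i))))

-- From a family of sparse sets to a monochromatic copy

module Monochromatic {n N d Δ q : ℕ} (H : Graph n) (ordered : Ordered d Δ H)
  (c : Fin n → Fin q) (proper : ∀ k i → adj H k i ≡ true → c k ≢ c i)
  (red : Fin N → Sub N) (red-sym : ∀ x y → red x y ≡ red y x)
  (1≤d : 1 ≤ d) (1≤Δ : 1 ≤ Δ) (1≤n : 1 ≤ n) (1≤q : 1 ≤ q) where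

  R : ℕ
  R = 8 * d * (q * q)

  instance
    R≢0 : NonZero R
    R≢0 = >-nonZero (*-mono-≤ (*-mono-≤ (s≤s (z≤n {7})) 1≤d) (*-mono-≤ 1≤q 1≤q))

  open Families H ordered red red-sym R 1≤Δ (4 * n)
    (*-mono-≤ (s≤s (z≤n {3})) 1≤n) (m≤n*m n 4) public

  copy : ∀ {M} → Good q M → M * (4 * n) ≤ N → Copy H red ⊎ Copy H (λ x y → not (red x y))
  copy {M} good N-large with good (λ _ → true) (subst (M * (4 * n) ≤_) (sym (♯-full N)) N-large)
  ... | inj₂ found = inj₁ found
  ... | inj₁ (W , inside , sparse) = inj₂ (BlueEmbedding.blue-copy H (Ordered.back ordered) c proper red
          1≤d 1≤n 1≤q W (proj₂ ∘ inside) sparse)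

-- Colouring a degenerate graph with `d + 1` colours

greedy-colouring : ∀ {d} (H : Graph n) → (∀ i → ♯ (earlier H i (toℕ i)) ≤ d) →
  ∃ λ (c : Fin n → Fin (suc d)) → ∀ k i → adj H k i ≡ true → c k ≢ c i
-- No condition is imposed on single colours, hence the one-element type `Fin 1`. A free colour
-- exists because at most `d` of the `d + 1` are taken.
greedy-colouring {n} {d} H back with greedy (λ _ _ → Fin 1) Q (λ _ → zero) choose
  where
  Q : Fin n → Fin n → Fin (suc d) → Fin (suc d) → Set
  Q k i x y = adj H k i ≡ true → x ≢ y
  choose : ∀ i (f : Fin n → Fin (suc d)) → _ → ∃ λ x → Fin 1 × ∀ k → toℕ k < toℕ i → Q k i (f k) x
  choose i f _ with exists-zero {suc d} (λ _ → true) weight small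
    where
    clash : Fin n → Sub (suc d)
    clash k x = earlier H i (toℕ i) k ∧ does (x ≟ f k)
    weight : Fin (suc d) → ℕ
    weight x = sum (λ k → ind (clash k x))
    bound : ∀ k → ∑∈ {suc d} (λ _ → true) (ind ∘ clash k) ≤ ind (earlier H i (toℕ i) k)
    bound k with earlier H i (toℕ i) k
    ... | true = ≤-reflexive (trans (∑∈-ind (λ _ → true) (λ x → does (x ≟ f k))) (♯-point (f k)))
    ... | false = ≤-reflexive (trans (∑∈-const {suc d} (λ _ → true) 0) (*-zeroʳ (♯ {suc d} (λ _ → true))))
    open ≤-Reasoning
    small : ∑∈ (λ _ → true) weight < ♯ {suc d} (λ _ → true)
    small = begin-strict
      ∑∈ {suc d} (λ _ → true) weight
        ≡⟨ ∑∈-sum {suc d} (λ _ → true) (λ k x → ind (clash k x)) ⟩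
      sum (λ k → ∑∈ {suc d} (λ _ → true) (ind ∘ clash k)) ≤⟨ sum-mono bound ⟩
      ♯ (earlier H i (toℕ i))                         ≤⟨ back i ⟩
      d                                               <⟨ n<1+n d ⟩
      suc d                                           ≡⟨ ♯-full (suc d) ⟨
      ♯ {suc d} (λ _ → true)                          ∎
  ... | x , _ , w≡0 = x , zero , λ k k<i ki → λ { refl → ind≡0 (sum≡0 _ w≡0 k)
          (∧-intro (∧-intro ki (true-does (suc (toℕ k) ≤? toℕ i) k<i)) (true-does (f k ≟ f k) refl)) }
... | f , ok = f , λ k i ki ck≡ci → differ k i ki ck≡ci (<-cmp (toℕ k) (toℕ i))
  where
  differ : ∀ k i → adj H k i ≡ true → f k ≡ f i → Tri (toℕ k < toℕ i) (toℕ k ≡ toℕ i) (toℕ i < toℕ k) → ⊥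
  differ k i ki eq (tri< k<i _ _) = ok k i k<i ki eq
  differ k i ki eq (tri> _ _ i<k) = ok i k i<k (trans (Graph.sym H i k) ki) (sym eq)
  differ k i ki eq (tri≈ _ k≡i _) with toℕ-injective k≡i
  ... | refl = contradiction (trans (sym (Graph.irrefl H k)) ki) λ ()

-- Arithmetic of the bound

^-distribʳ-* : ∀ o m n → (m * n) ^ o ≡ m ^ o * n ^ o
^-distribʳ-* zero m n = refl
^-distribʳ-* (suc o) m n = trans (cong (m * n *_) (^-distribʳ-* o m n)) (lemma m n (m ^ o) (n ^ o))
  where
  lemma : ∀ a b c d → a * b * (c * d) ≡ a * c * (b * d)
  lemma = solve-∀

2^-cancel-≤ : ∀ a b → 2 ^ a ≤ 2 ^ b → a ≤ b
2^-cancel-≤ a b h = ≮⇒≥ λ b<a → <⇒≱ (^-monoʳ-< 2 ≤-refl b<a) h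

log-floor : ∀ q → 1 ≤ q → ∃ λ l → 2 ^ l ≤ q × q < 2 ^ suc l
log-floor 1 _ = 0 , ≤-refl , ≤-refl
log-floor (suc q@(suc _)) _ with log-floor q (s≤s z≤n)
... | l , 2^l≤q , q<2^l+1 with suc q <? 2 ^ suc l
...   | yes 1+q< = l , m≤n⇒m≤1+n 2^l≤q , 1+q<
...   | no 1+q≮ = suc l , ≮⇒≥ 1+q≮ , ≤-<-trans q<2^l+1 (^-monoʳ-< 2 ≤-refl (n<1+n (suc l)))

-- It makes `l + 1` at most `4/3` of log q. The first two cases use `q ≥ 3` and `q ≥ 5`; from
-- `l = 3` on, `3 (l + 1) ≤ 4 l` suffices.
2^3[1+l]≤q^4 : ∀ l q → 1 ≤ l → 2 ^ l < q → 2 ^ (3 * suc l) ≤ q ^ 4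
2^3[1+l]≤q^4 1 q _ h = ≤-trans (from-yes (64 ≤? 3 ^ 4)) (^-monoˡ-≤ 4 h)
2^3[1+l]≤q^4 2 q _ h = ≤-trans (from-yes (512 ≤? 5 ^ 4)) (^-monoˡ-≤ 4 h)
2^3[1+l]≤q^4 l@(suc (suc (suc m))) q _ h = begin
  2 ^ (3 * suc l)    ≤⟨ ^-monoʳ-≤ 2 (subst₂ _≤_ (lemma₁ m) (lemma₂ m) (m≤m+n (3 * m + 12) m)) ⟩
  2 ^ (l * 4)        ≡⟨ ^-*-assoc 2 l 4 ⟨
  (2 ^ l) ^ 4        ≤⟨ ^-monoˡ-≤ 4 (<⇒≤ h) ⟩
  q ^ 4              ∎
  where
  open ≤-Reasoning
  lemma₁ : ∀ m → 3 * m + 12 ≡ 3 * suc (suc (suc (suc m)))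
  lemma₁ = solve-∀
  lemma₂ : ∀ m → 3 * m + 12 + m ≡ suc (suc (suc m)) * 4
  lemma₂ = solve-∀

-- The fraction `p / e` stands for an upper bound of log q. Every estimate is raised to the power
-- `e`, so `p` plays the role of log q and `ke` that of the number of levels `k`.
module Numeric (d Δ q l a n p e : ℕ) (1≤d : 1 ≤ d) (1≤Δ : 1 ≤ Δ) (q^e≤ : q ^ e ≤ 2 ^ p)
  (e≤p : e ≤ p) (ae≤p : a * e ≤ p) (le≤p : l * e ≤ p) (3ke≤4p : 3 * suc l * e ≤ 4 * p) (2^l≤d : 2 ^ l ≤ d) where

  open ≤-Reasoning

  k ke : ℕ
  k = suc l
  ke = k * e

  instance
    d≢0 : NonZero d
    d≢0 = >-nonZero 1≤d

  ke≤2p : ke ≤ 2 * p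
  ke≤2p = subst (ke ≤_) (cong (p +_) (sym (+-identityʳ p))) (+-mono-≤ e≤p le≤p)

  -- r ≤ e, hence l r ≤ p, so 2 ^ (2 l p) = (2 ^ l) ^ (2 p - r) * 2 ^ (l r) ≤ d ^ (2 p - r) * 2 ^ p.
  r : ℕ
  r = ke ∸ p

  r≤e : r ≤ e
  r≤e = m≤n+o⇒m∸n≤o ke p (subst (_≤ p + e) (+-comm (l * e) e) (+-monoˡ-≤ e le≤p))

  r≤2p : r ≤ 2 * p
  r≤2p = ≤-trans r≤e (≤-trans e≤p (m≤m+n p (p + 0)))

  powers : 2 ^ (l * (2 * p)) * d ^ r ≤ 2 ^ p * d ^ (2 * p)
  powers = begin
    2 ^ (l * (2 * p)) * d ^ r
      ≡⟨ cong (λ x → 2 ^ (l * x) * d ^ r) (m∸n+n≡m r≤2p) ⟨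
    2 ^ (l * (w + r)) * d ^ r
      ≡⟨ cong (λ x → 2 ^ x * d ^ r) (*-distribˡ-+ l w r) ⟩
    2 ^ (l * w + l * r) * d ^ r
      ≡⟨ cong (_* d ^ r) (^-distribˡ-+-* 2 (l * w) (l * r)) ⟩
    2 ^ (l * w) * 2 ^ (l * r) * d ^ r
      ≤⟨ *-monoˡ-≤ (d ^ r) (*-mono-≤ first second) ⟩
    d ^ w * 2 ^ p * d ^ r                              ≡⟨ lemma (d ^ w) (2 ^ p) (d ^ r) ⟩
    2 ^ p * (d ^ w * d ^ r)                            ≡⟨ cong (2 ^ p *_) (^-distribˡ-+-* d w r) ⟨
    2 ^ p * d ^ (w + r)
      ≡⟨ cong (λ x → 2 ^ p * d ^ x) (m∸n+n≡m r≤2p) ⟩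
    2 ^ p * d ^ (2 * p)                                ∎
    where
    w = 2 * p ∸ r
    lemma : ∀ x y z → x * y * z ≡ y * (x * z)
    lemma = solve-∀
    first : 2 ^ (l * w) ≤ d ^ w
    first = subst (_≤ d ^ w) (^-*-assoc 2 l w) (^-monoˡ-≤ w 2^l≤d)
    second : 2 ^ (l * r) ≤ 2 ^ p
    second = ^-monoʳ-≤ 2 (≤-trans (*-monoʳ-≤ l r≤e) le≤p)

  -- The excess of `k` over log q is paid by trading powers of `2 ^ l` for powers of `d`, as
  -- `2 ^ l ≤ d`.
  d-part : 2 ^ (2 * (k * p)) * d ^ ke ≤ 2 ^ (3 * p) * d ^ (3 * p)
  d-part = begin
    2 ^ (2 * (k * p)) * d ^ ke
      -- With truncated subtraction, `ke ≤ p + r` holds whichever of `ke` and `p` is larger.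
      ≤⟨ *-monoʳ-≤ (2 ^ (2 * (k * p))) (^-monoʳ-≤ d (m≤n+m∸n ke p)) ⟩
    2 ^ (2 * (k * p)) * d ^ (p + r)
      ≡⟨ cong₂ _*_ (trans (cong (2 ^_) (expand l p)) (^-distribˡ-+-* 2 (2 * p) (l * (2 * p)))) (^-distribˡ-+-* d p r) ⟩
    2 ^ (2 * p) * 2 ^ (l * (2 * p)) * (d ^ p * d ^ r)
      ≡⟨ lemma (2 ^ (2 * p)) (2 ^ (l * (2 * p))) (d ^ p) (d ^ r) ⟩
    2 ^ (2 * p) * d ^ p * (2 ^ (l * (2 * p)) * d ^ r)   ≤⟨ *-monoʳ-≤ (2 ^ (2 * p) * d ^ p) powers ⟩
    2 ^ (2 * p) * d ^ p * (2 ^ p * d ^ (2 * p))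
      ≡⟨ lemma′ (2 ^ (2 * p)) (d ^ p) (2 ^ p) (d ^ (2 * p)) ⟩
    2 ^ p * 2 ^ (2 * p) * (d ^ p * d ^ (2 * p))
      ≡⟨ cong₂ _*_ (^-distribˡ-+-* 2 p (2 * p)) (^-distribˡ-+-* d p (2 * p)) ⟨
    2 ^ (3 * p) * d ^ (3 * p)                           ∎
    where
    expand : ∀ l p → 2 * (suc l * p) ≡ 2 * p + l * (2 * p)
    expand = solve-∀
    lemma : ∀ x y z w → x * y * (z * w) ≡ x * z * (y * w)
    lemma = solve-∀
    lemma′ : ∀ x y z w → x * y * (z * w) ≡ z * x * (y * w)
    lemma′ = solve-∀

  R L : ℕ
  R = 8 * d * (q * q)
  L = 2 * R ^ d

  -- The 7 is 4 + 3: `8 ^ ke` costs `2 ^ (4 * p)` through `3ke≤4p`, and the powers of `q` and `d`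
  -- cost a further `2 ^ (3 * p)` by `d-part`.
  R-part : R ^ ke ≤ 2 ^ (7 * p) * d ^ (3 * p)
  R-part = begin
    R ^ ke
      ≡⟨ trans (^-distribʳ-* ke (8 * d) (q * q)) (cong (_* (q * q) ^ ke) (^-distribʳ-* ke 8 d)) ⟩
    8 ^ ke * d ^ ke * (q * q) ^ ke                  ≤⟨ *-mono-≤ (*-monoˡ-≤ (d ^ ke) eight) squares ⟩
    2 ^ (4 * p) * d ^ ke * 2 ^ (2 * (k * p))
      ≡⟨ lemma (2 ^ (4 * p)) (d ^ ke) (2 ^ (2 * (k * p))) ⟩
    2 ^ (4 * p) * (2 ^ (2 * (k * p)) * d ^ ke)      ≤⟨ *-monoʳ-≤ (2 ^ (4 * p)) d-part ⟩
    2 ^ (4 * p) * (2 ^ (3 * p) * d ^ (3 * p))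
      ≡⟨ *-assoc (2 ^ (4 * p)) (2 ^ (3 * p)) (d ^ (3 * p)) ⟨
    2 ^ (4 * p) * 2 ^ (3 * p) * d ^ (3 * p)
      ≡⟨ cong (_* d ^ (3 * p)) (^-distribˡ-+-* 2 (4 * p) (3 * p)) ⟨
    2 ^ (4 * p + 3 * p) * d ^ (3 * p)
      ≡⟨ cong (λ x → 2 ^ x * d ^ (3 * p)) (*-distribʳ-+ p 4 3) ⟨
    2 ^ (7 * p) * d ^ (3 * p)                       ∎
    where
    lemma : ∀ x y z → x * y * z ≡ x * (z * y)
    lemma = solve-∀
    eight : 8 ^ ke ≤ 2 ^ (4 * p)
    eight = subst (_≤ 2 ^ (4 * p)) (sym (^-*-assoc 2 3 ke))
      (^-monoʳ-≤ 2 (subst (_≤ 4 * p) (*-assoc 3 k e) 3ke≤4p))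
    squares : (q * q) ^ ke ≤ 2 ^ (2 * (k * p))
    squares = begin
      (q * q) ^ ke             ≡⟨ cong (λ x → (q * x) ^ ke) (*-identityʳ q) ⟨
      (q ^ 2) ^ ke             ≡⟨ ^-*-assoc q 2 ke ⟩
      q ^ (2 * (k * e))        ≡⟨ cong (q ^_) (swap k e) ⟩
      q ^ (e * (2 * k))        ≡⟨ ^-*-assoc q e (2 * k) ⟨
      (q ^ e) ^ (2 * k)        ≤⟨ ^-monoˡ-≤ (2 * k) q^e≤ ⟩
      (2 ^ p) ^ (2 * k)        ≡⟨ ^-*-assoc 2 p (2 * k) ⟩
      2 ^ (p * (2 * k))        ≡⟨ cong (2 ^_) (swap k p) ⟨
      2 ^ (2 * (k * p))        ∎
      where
      swap : ∀ k e → 2 * (k * e) ≡ e * (2 * k)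
      swap = solve-∀

  L-part : L ^ ke ≤ 2 ^ (2 * p) * (2 ^ (7 * p) * d ^ (3 * p)) ^ d
  L-part = begin
    L ^ ke                                                   ≡⟨ ^-distribʳ-* ke 2 (R ^ d) ⟩
    2 ^ ke * (R ^ d) ^ ke
      ≡⟨ cong (2 ^ ke *_) (trans (^-*-assoc R d ke) (trans (cong (R ^_) (*-comm d ke)) (sym (^-*-assoc R ke d)))) ⟩
    2 ^ ke * (R ^ ke) ^ d
      ≤⟨ *-mono-≤ (^-monoʳ-≤ 2 ke≤2p) (^-monoˡ-≤ d R-part) ⟩
    2 ^ (2 * p) * (2 ^ (7 * p) * d ^ (3 * p)) ^ d            ∎

  -- The exponent `4 * p` collects `2 * p` from `L-part` and `2 * p` from the factor 4 in `4 * n`;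
  -- the target leaves room for `8 * p` and for two further powers of `d`.
  X-power : 2 ^ (4 * p) * (2 ^ (7 * p) * d ^ (3 * p)) ^ d * Δ ^ p ≤ (2 ^ (7 * d + 8) * d ^ (3 * d + 2) * Δ) ^ p
  X-power = begin
    2 ^ (4 * p) * (2 ^ (7 * p) * d ^ (3 * p)) ^ d * Δ ^ p
      ≡⟨ cong (λ x → 2 ^ (4 * p) * x * Δ ^ p) (trans (^-distribʳ-* d (2 ^ (7 * p)) (d ^ (3 * p)))
                                                                     (cong₂ _*_ (^-*-assoc 2 (7 * p) d) (^-*-assoc d (3 * p) d))) ⟩
    2 ^ (4 * p) * (2 ^ (7 * p * d) * d ^ (3 * p * d)) * Δ ^ p
      ≡⟨ cong (_* Δ ^ p) (trans (sym (*-assoc (2 ^ (4 * p)) (2 ^ (7 * p * d)) (d ^ (3 * p * d)))) (cong (_* d ^ (3 * p * d)) (sym (^-distribˡ-+-* 2 (4 * p) (7 * p * d))))) ⟩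
    2 ^ (4 * p + 7 * p * d) * d ^ (3 * p * d) * Δ ^ p          ≤⟨ *-monoˡ-≤ (Δ ^ p) (*-mono-≤
                                                                     (^-monoʳ-≤ 2 (subst (4 * p + 7 * p * d ≤_) (two d p) (m≤m+n _ (4 * p))))
                                                                     (^-monoʳ-≤ d (subst (3 * p * d ≤_) (dee d p) (m≤m+n _ (2 * p))))) ⟩
    2 ^ ((7 * d + 8) * p) * d ^ ((3 * d + 2) * p) * Δ ^ p
      ≡⟨ cong (_* Δ ^ p) (cong₂ _*_ (^-*-assoc 2 (7 * d + 8) p) (^-*-assoc d (3 * d + 2) p)) ⟨
    (2 ^ (7 * d + 8)) ^ p * (d ^ (3 * d + 2)) ^ p * Δ ^ p
      ≡⟨ trans (^-distribʳ-* p (2 ^ (7 * d + 8) * d ^ (3 * d + 2)) Δ) (cong (_* Δ ^ p) (^-distribʳ-* p (2 ^ (7 * d + 8)) (d ^ (3 * d + 2)))) ⟨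
    (2 ^ (7 * d + 8) * d ^ (3 * d + 2) * Δ) ^ p                ∎
    where
    two : ∀ d p → 4 * p + 7 * p * d + 4 * p ≡ (7 * d + 8) * p
    two = solve-∀
    dee : ∀ d p → 3 * p * d + 2 * p ≡ (3 * d + 2) * p
    dee = solve-∀

  bound : (L ^ k * Δ ^ a * (4 * n)) ^ e ≤ n ^ e * (2 ^ (7 * d + 8) * d ^ (3 * d + 2) * Δ) ^ p
  bound = begin
    (L ^ k * Δ ^ a * (4 * n)) ^ e
      ≡⟨ trans (^-distribʳ-* e (L ^ k * Δ ^ a) (4 * n)) (cong₂ _*_ (^-distribʳ-* e (L ^ k) (Δ ^ a)) (^-distribʳ-* e 4 n)) ⟩
    (L ^ k) ^ e * (Δ ^ a) ^ e * (4 ^ e * n ^ e)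
      ≡⟨ cong₂ (λ x y → x * y * (4 ^ e * n ^ e)) (^-*-assoc L k e) (^-*-assoc Δ a e) ⟩
    L ^ ke * Δ ^ (a * e) * (4 ^ e * n ^ e)
      ≤⟨ *-mono-≤ (*-mono-≤ L-part (^-monoʳ-≤ Δ ⦃ >-nonZero 1≤Δ ⦄ ae≤p)) (*-monoˡ-≤ (n ^ e) four) ⟩
    2 ^ (2 * p) * Y * Δ ^ p * (2 ^ (2 * p) * n ^ e)  ≡⟨ lemma (2 ^ (2 * p)) Y (Δ ^ p) (n ^ e) ⟩
    n ^ e * (2 ^ (2 * p) * 2 ^ (2 * p) * Y * Δ ^ p)
      ≡⟨ cong (λ x → n ^ e * (x * Y * Δ ^ p)) (trans (sym (^-distribˡ-+-* 2 (2 * p) (2 * p))) (cong (2 ^_) (sym (*-distribʳ-+ p 2 2)))) ⟩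
    n ^ e * (2 ^ (4 * p) * Y * Δ ^ p)                ≤⟨ *-monoʳ-≤ (n ^ e) X-power ⟩
    n ^ e * (2 ^ (7 * d + 8) * d ^ (3 * d + 2) * Δ) ^ p ∎
    where
    Y = (2 ^ (7 * p) * d ^ (3 * p)) ^ d
    lemma : ∀ a b c x → a * b * c * (a * x) ≡ x * (a * a * b * c)
    lemma = solve-∀
    four : 4 ^ e ≤ 2 ^ (2 * p)
    four = subst (_≤ 2 ^ (2 * p)) (sym (^-*-assoc 2 2 e)) (^-monoʳ-≤ 2 (*-monoʳ-≤ 2 e≤p))

-- Decidability of Arrows and the Ramsey number

-- If `y` were missed, punching it out would inject `Fin (suc n)` into `Fin n`.
injective⇒onto : {f : Fin n → Fin n} → Injective _≡_ _≡_ f → ∀ y → ∃ λ x → f x ≡ y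
injective⇒onto {suc n} {f} f-inj y with any? (λ x → f x ≟ y)
... | yes found = found
... | no none = contradiction
  (λ {x} {x′} eq → f-inj (punchOut-injective (λ h → none (x , sym h)) (λ h → none (x′ , sym h)) eq))
  (<⇒notInjective {f = λ x → punchOut {i = y} {j = f x} (λ h → none (x , sym h))} ≤-refl)

relabel : Graph n → (Fin n → Fin n) → Graph n
relabel H ord = record
  { adj = λ i j → adj H (ord i) (ord j)
  ; sym = λ i j → Graph.sym H (ord i) (ord j)
  ; irrefl = λ i → irrefl H (ord i) }

degenerate⇒ordered : ∀ {d Δ} (H : Graph n) ((ord , _) : Degenerate d Δ H) → Ordered d Δ (relabel H ord)
degenerate⇒ordered {n} {d} {Δ} H (ord , _ , deg) = record { back = back ; traces = traces }
  where
  back : ∀ i → ♯ (earlier (relabel H ord) i (toℕ i)) ≤ d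
  back i = subst (_≤ d) (trans (countFin≡♯ (λ j → adj H (ord j) (ord i) ∧ ⌊ suc (toℕ j) ≤? toℕ i ⌋))
      (sum-cong-≗ λ j → cong (λ b → ind (adj H (ord j) (ord i) ∧ b)) (isYes≗does (suc (toℕ j) ≤? toℕ i))))
    (proj₁ (deg i))
  traces : ∀ i → _
  traces i with proj₂ (deg i)
  ... | L , short , covers = List.map Vec.lookup L , subst (_≤ Δ) (sym (length-map Vec.lookup L)) short , λ j i<j ji →
    let τ∈ = ∈-map⁺ Vec.lookup (covers j i<j ji) in
    index τ∈ , λ k k<i → trans (cong (λ S → S k) (sym (lookup-index τ∈)))
      (trans (lookup∘tabulate _ k) (entry j k k<i))
    where
    entry : ∀ j k → toℕ k < toℕ i → adj H (ord j) (ord k) ∧ ⌊ toℕ k ≤? toℕ i ⌋ ≡ adj H (ord k) (ord j)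
    entry j k k<i rewrite isYes≗does (toℕ k ≤? toℕ i) | true-does (toℕ k ≤? toℕ i) (<⇒≤ k<i) =
      trans (Bool.∧-identityʳ _) (Graph.sym H (ord j) (ord k))

Embeds : Graph n → (Fin m → Fin m → Bool) → Bool → (Fin n → Fin m) → Set
Embeds H col b f = Injective _≡_ _≡_ f × (∀ u v → adj H u v ≡ true → col (f u) (f v) ≡ b)

Monochrome : Graph n → (Fin m → Fin m → Bool) → Set
Monochrome {n} {m} H col = ∃[ b ] Σ (Fin n → Fin m) (Embeds H col b)

copy⇒embeds : (H : Graph n) {ord : Fin n → Fin n} → Injective _≡_ _≡_ ord →
  (col : Fin m → Fin m → Bool) → (∀ x y → col x y ≡ col y x) →
  Copy (relabel H ord) col → Σ (Fin n → Fin m) (Embeds H col true)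
copy⇒embeds {n} {m} H {ord} ord-inj col col-sym (f , ok) = f ∘ pos , (λ {u} {v} → injective u v) , coloured
  where
  pos : Fin n → Fin n
  pos u = proj₁ (injective⇒onto ord-inj u)
  ord-pos : ∀ u → ord (pos u) ≡ u
  ord-pos u = proj₂ (injective⇒onto ord-inj u)
  injective′ : ∀ i j → f i ≡ f j → i ≡ j
  injective′ i j eq with <-cmp (toℕ i) (toℕ j)
  ... | tri< i<j _ _ = contradiction eq (proj₁ (ok i j i<j))
  ... | tri≈ _ i≡j _ = toℕ-injective i≡j
  ... | tri> _ _ j<i = contradiction (sym eq) (proj₁ (ok j i j<i))
  injective : ∀ u v → f (pos u) ≡ f (pos v) → u ≡ v
  injective u v eq = trans (sym (ord-pos u)) (trans (cong ord (injective′ _ _ eq)) (ord-pos v))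
  coloured′ : ∀ i j → adj H (ord i) (ord j) ≡ true → col (f i) (f j) ≡ true
  coloured′ i j ij with <-cmp (toℕ i) (toℕ j)
  ... | tri< i<j _ _ = proj₂ (ok i j i<j) ij
  ... | tri> _ _ j<i = trans (col-sym _ _) (proj₂ (ok j i j<i) (trans (Graph.sym H _ _) ij))
  ... | tri≈ _ i≡j _ with toℕ-injective i≡j
  ...   | refl = contradiction (trans (sym (irrefl H (ord i))) ij) λ ()
  coloured : ∀ u v → adj H u v ≡ true → col (f (pos u)) (f (pos v)) ≡ true
  coloured u v uv = coloured′ (pos u) (pos v) (subst₂ (λ x y → adj H x y ≡ true) (sym (ord-pos u)) (sym (ord-pos v)) uv)

embeds? : (H : Graph n) (col : Fin m → Fin m → Bool) (b : Bool) (f : Fin n → Fin m) → Dec (Embeds H col b f)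
embeds? H col b f =
  map′ (λ h {x} {y} → h x y) (λ h x y → h) (all? λ x → all? λ y → (f x ≟ f y) →-dec (x ≟ y))
  ×-dec (all? λ u → all? λ v → (adj H u v Bool.≟ true) →-dec (col (f u) (f v) Bool.≟ b))

embeds-cong : (H : Graph n) {col col′ : Fin m → Fin m → Bool} (b : Bool) {f f′ : Fin n → Fin m} →
  (∀ x y → col x y ≡ col′ x y) → (∀ u → f u ≡ f′ u) → Embeds H col b f → Embeds H col′ b f′
embeds-cong H {col} b {f} {f′} col≗ f≗ (inj , ok) =
  (λ {x} {y} eq → inj (trans (f≗ x) (trans eq (sym (f≗ y))))) ,
  λ u v uv → trans (sym (col≗ (f′ u) (f′ v))) (subst₂ (λ x y → col x y ≡ b) (f≗ u) (f≗ v) (ok u v uv))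

-- Maps are searched through their codes in `Fin (m ^ n)`; decoding agrees with the original map
-- pointwise, and `embeds-cong` transports along that.
monochrome? : (H : Graph n) (col : Fin m → Fin m → Bool) → Dec (Monochrome H col)
monochrome? {n} {m} H col = map′
  (λ { (inj₁ (c , h)) → true , finToFun c , h ; (inj₂ (c , h)) → false , finToFun c , h })
  (λ { (true , f , h) → inj₁ (encode true f h) ; (false , f , h) → inj₂ (encode false f h) })
  (search true ⊎-dec search false)
  where
  Coded : Bool → Set
  Coded b = ∃ λ (c : Fin (m ^ n)) → Embeds H col b (finToFun c)
  search : ∀ b → Dec (Coded b)
  search b = any? λ c → embeds? H col b (finToFun c)
  encode : ∀ b (f : Fin n → Fin m) → Embeds H col b f → Coded b
  encode b f h = funToFin f , embeds-cong H {col} b (λ _ _ → refl) (λ u → sym (finToFun-funToFin f u)) h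

-- A colouring is coded as a subset of the `N * N` pairs, so the search for a counterexample is
-- finite. This decision is what lets the least `N` be found.
arrows? : (N : ℕ) (H : Graph n) → Dec (Arrows N H)
arrows? N H with anySubset? (λ S → symmetric? (decode S) ×-dec ¬? (monochrome? H (decode S)))
  where
  decode : Subset (N * N) → Fin N → Fin N → Bool
  decode S x y = Vec.lookup S (combine x y)
  symmetric? : (col : Fin N → Fin N → Bool) → Dec (∀ x y → col x y ≡ col y x)
  symmetric? col = all? λ x → all? λ y → col x y Bool.≟ col y x
... | yes (S , sym-S , none) = no λ arrows → none (arrows (_ , sym-S))
... | no no-counterexample = yes λ (col , col-sym) → decidable-stable (monochrome? H col) λ none →
  let code = Vec.tabulate (λ z → col (proj₁ (remQuot N z)) (proj₂ (remQuot {N} N z)))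
      decoded : ∀ x y → Vec.lookup code (combine x y) ≡ col x y
      decoded x y = trans (lookup∘tabulate _ (combine x y))
        (cong (λ z → col (proj₁ z) (proj₂ z)) (remQuot-combine x y))
  in no-counterexample (code , (λ x y → trans (decoded x y) (trans (col-sym x y) (sym (decoded y x)))) ,
       λ (b , f , h) → none (b , f , embeds-cong H b decoded (λ _ → refl) h))

least-positive : {P : ℕ → Set} → (∀ t → Dec (P t)) → ∀ {N} → 1 ≤ N → P N →
  ∃ λ r → (1 ≤ r × P r × (∀ M → 1 ≤ M → P M → r ≤ M)) × r ≤ N
least-positive {P} P? {N} 1≤N pN with search N
  where
  Least : ℕ → Set
  Least r = 1 ≤ r × P r × (∀ M → 1 ≤ M → P M → r ≤ M)
  search : ∀ t → (∃ Least) ⊎ (∀ M → 1 ≤ M → M ≤ t → ¬ P M)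
  search zero = inj₂ λ { (suc _) _ () _ }
  search (suc t) with search t
  ... | inj₁ found = inj₁ found
  ... | inj₂ none with P? (suc t)
  ...   | yes p = inj₁ (suc t , s≤s z≤n , p , λ M 1≤M pM → ≰⇒> λ M≤t → none M 1≤M M≤t pM)
  ...   | no ¬p = inj₂ λ M 1≤M M≤1+t pM →
    [ (λ { (s≤s M≤t) → none M 1≤M M≤t pM }) , (λ { refl → ¬p pM }) ]′ (m≤n⇒m<n∨m≡n M≤1+t)
... | inj₁ (r , least) = r , least , proj₂ (proj₂ least) N 1≤N pN
... | inj₂ none = contradiction pN (none N 1≤N ≤-refl)

ramsey-number : (H : Graph n) {N : ℕ} → 1 ≤ N → Arrows N H → ∃ λ r → IsRamseyNumber H r × r ≤ N
ramsey-number H = least-positive λ N → arrows? N H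

-- Degenerate cases, choice of exponents and the final estimate

le-real-pow : ∀ {r n} X q → (X ≡ 0 → r ≤ zeroPowLog q * n) →
  (1 ≤ X → ∀ p e → 1 ≤ e → q ^ e ≤ 2 ^ p → r ^ e ≤ n ^ e * X ^ p) → LeRealPow r n X q
le-real-pow zero q h _ = h refl
le-real-pow (suc X) q _ h = h (s≤s z≤n)

chromatic≤1+d : ∀ {d Δ q} (H : Graph n) → Degenerate d Δ H → IsChromaticNumber H q → q ≤ suc d
chromatic≤1+d {n} {d} H deg@(ord , ord-inj , _) (_ , minimal)
  with greedy-colouring (relabel H ord) (Ordered.back (degenerate⇒ordered H deg))
... | c , proper = minimal (suc d) (c ∘ pos , λ u v uv →
    proper (pos u) (pos v) (subst₂ (λ x y → adj H x y ≡ true) (sym (ord-pos u)) (sym (ord-pos v)) uv))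
  where
  pos : Fin n → Fin n
  pos u = proj₁ (injective⇒onto ord-inj u)
  ord-pos : ∀ u → ord (pos u) ≡ u
  ord-pos u = proj₂ (injective⇒onto ord-inj u)

-- With no trace allowed, no vertex has a later neighbour, so `H` has no edges.
Δ≡0⇒chromatic≤1 : ∀ {d q} (H : Graph n) → Degenerate d 0 H → IsChromaticNumber H q → q ≤ 1
Δ≡0⇒chromatic≤1 {n} {d} H deg@(ord , ord-inj , _) (_ , minimal) =
  minimal 1 ((λ _ → zero) , λ u v uv → contradiction uv (no-edge u v))
  where
  open Ordered (degenerate⇒ordered H deg)
  none : ∀ i j → toℕ i < toℕ j → adj H (ord j) (ord i) ≢ true
  none i j i<j ji with traces i
  ... | List.[] , _ , covers = contradiction (proj₁ (covers j i<j ji)) ¬Fin0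
  no-edge′ : ∀ i j → adj H (ord i) (ord j) ≢ true
  no-edge′ i j ij with <-cmp (toℕ i) (toℕ j)
  ... | tri< i<j _ _ = none i j i<j (trans (Graph.sym H _ _) ij)
  ... | tri> _ _ j<i = none j i j<i ij
  ... | tri≈ _ i≡j _ with toℕ-injective i≡j
  ...   | refl = contradiction (trans (sym (irrefl H (ord i))) ij) λ ()
  no-edge : ∀ u v → adj H u v ≢ true
  no-edge u v uv with injective⇒onto ord-inj u | injective⇒onto ord-inj v
  ... | i , refl | j , refl = no-edge′ i j uv

arrows-edgeless : (H : Graph n) → (∀ u v → adj H u v ≢ true) → Arrows n H
arrows-edgeless H none _ = true , id , id , λ u v uv → contradiction uv (none u v)

-- The exponents 1 + l of L and a of Δ: q = 2 ^ (1 + l) costs (L Δ) ^ (1 + l), while every other q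
-- with ⌊log q⌋ = l costs L ^ (1 + l) Δ ^ l.
record Exponents (d q : ℕ) : Set where
  field
    l a : ℕ
    2^l≤d : 2 ^ l ≤ d
    l-log : ∀ p e → q ^ e ≤ 2 ^ p → l * e ≤ p
    a-log : ∀ p e → q ^ e ≤ 2 ^ p → a * e ≤ p
    k-log : ∀ p e → q ^ e ≤ 2 ^ p → 3 * suc l * e ≤ 4 * p
    shape : (a ≡ suc l × q ≤ 2 ^ suc l) ⊎ (a ≡ l × q < 2 ^ suc l)

below-log : ∀ q l → 2 ^ l ≤ q → ∀ p e → q ^ e ≤ 2 ^ p → l * e ≤ p
below-log q l 2^l≤q p e q^e≤ = 2^-cancel-≤ (l * e) p
  (≤-trans (≤-reflexive (sym (^-*-assoc 2 l e))) (≤-trans (^-monoˡ-≤ e 2^l≤q) q^e≤))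

exponents : ∀ {d q} → 2 ≤ q → q ≤ suc d → Exponents d q
exponents {d} {q} 2≤q q≤1+d with log-floor q (≤-trans (s≤s z≤n) 2≤q)
... | zero , _ , q<2 = contradiction q<2 (≤⇒≯ 2≤q)
... | suc l , 2^l≤q , q<2^l+1 with m≤n⇒m<n∨m≡n 2^l≤q
-- Here log q is exactly `suc l`. The field `l` is set one below it, so that `suc l` counts the
-- levels and `2 ^ l < q ≤ d + 1`.
...   | inj₂ 2^l≡q = record
  { l = l ; a = suc l
  ; 2^l≤d = ≤-pred (≤-trans (^-monoʳ-< 2 ≤-refl (n<1+n l)) (≤-trans 2^l≤q q≤1+d))
  ; l-log = λ p e h → ≤-trans (*-monoˡ-≤ e (n≤1+n l)) (below-log q (suc l) 2^l≤q p e h)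
  ; a-log = below-log q (suc l) 2^l≤q
  ; k-log = λ p e h → ≤-trans (≤-reflexive (*-assoc 3 (suc l) e)) (*-mono-≤ (n≤1+n 3) (below-log q (suc l) 2^l≤q p e h))
  ; shape = inj₁ (refl , ≤-reflexive (sym 2^l≡q)) }
...   | inj₁ 2^l<q = record
  { l = suc l ; a = suc l
  ; 2^l≤d = ≤-pred (≤-trans 2^l<q q≤1+d)
  ; l-log = below-log q (suc l) 2^l≤q
  ; a-log = below-log q (suc l) 2^l≤q
  -- The bound is applied to `q ^ 4`, whose logarithm is at least three times the number of levels.
  ; k-log = λ p e h → below-log (q ^ 4) (3 * suc (suc l)) (2^3[1+l]≤q^4 (suc l) q (s≤s z≤n) 2^l<q) (4 * p) e
      (≤-trans (≤-reflexive (trans (^-*-assoc q 4 e) (trans (cong (q ^_) (*-comm 4 e)) (sym (^-*-assoc q e 4)))))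
      (≤-trans (^-monoˡ-≤ 4 h) (≤-reflexive (trans (^-*-assoc 2 p 4) (cong (2 ^_) (*-comm p 4))))))
  ; shape = inj₂ (refl , q<2^l+1) }

arrows-bound : ∀ {d Δ q} (H : Graph n) → 1 ≤ n → 1 ≤ d → 1 ≤ Δ → 1 ≤ q →
  Degenerate d Δ H → ProperColouring H q → (E : Exponents d q) → (let open Exponents E) →
  Arrows ((2 * (8 * d * (q * q)) ^ d) ^ suc l * Δ ^ a * (4 * n)) H
arrows-bound {n} {d} {Δ} {q} H 1≤n 1≤d 1≤Δ 1≤q deg@(ord , ord-inj , _) (c , proper) E (col , col-sym) =
  conclude (copy {L ^ suc l * Δ ^ a} good ≤-refl)
  where
  open Exponents E
  open Monochromatic (relabel H ord) (degenerate⇒ordered H deg) (c ∘ ord) (λ k i → proper (ord k) (ord i))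
    col col-sym 1≤d 1≤Δ 1≤n 1≤q
  good : Good q (L ^ suc l * Δ ^ a)
  good with shape
  ... | inj₁ (refl , q≤) = subst (Good q) (^-distribʳ-* (suc l) L Δ) (good-power (suc l) q 1≤q q≤)
  ... | inj₂ (refl , q<) = subst (Good q)
    (trans (cong (L *_) (^-distribʳ-* l L Δ)) (sym (*-assoc L (L ^ l) (Δ ^ l)))) (good-nonpower l q 1≤q q<)
  not-true : ∀ {b} → not b ≡ true → b ≡ false
  not-true {false} _ = refl
  conclude : Copy (relabel H ord) col ⊎ Copy (relabel H ord) (λ x y → not (col x y)) → Monochrome H col
  conclude (inj₁ red) = let f , embeds = copy⇒embeds H ord-inj col col-sym red in true , f , embeds
  conclude (inj₂ blue) =
    let f , inj , ok = copy⇒embeds H ord-inj (λ x y → not (col x y)) (λ x y → cong not (col-sym x y)) blue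
    in false , f , inj , λ u v uv → not-true (ok u v uv)

theorem3p1 : ∀ {n : ℕ} (H : Graph n) (d Δ q : ℕ) → 1 ≤ n →
    Degenerate d Δ H → IsChromaticNumber H q →
    ∃[ r ] (IsRamseyNumber H r ×
    LeRealPow r n (2 ^ (7 * d + 8) * d ^ (3 * d + 2) * Δ) q)
theorem3p1 {suc _} H d Δ 0 _ _ ((c , _) , _) = contradiction (c zero) ¬Fin0
theorem3p1 {n} H d Δ 1 1≤n deg ((c , proper) , _)
  with ramsey-number H 1≤n (arrows-edgeless H λ u v uv → proper u v uv (one-point (c u) (c v)))
  where
  one-point : (i j : Fin 1) → i ≡ j
  one-point zero zero = refl
... | r , isRamsey , r≤n = r , isRamsey , le-real-pow (2 ^ (7 * d + 8) * d ^ (3 * d + 2) * Δ) 1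
  -- For `X = 0` the convention that zero to the power log 1 is 1 leaves exactly the bound `n`.
  (λ _ → ≤-trans r≤n (≤-reflexive (sym (*-identityˡ n))))
  λ 1≤X p e _ _ → ≤-trans (^-monoˡ-≤ e r≤n) (m≤m*n (n ^ e) _ ⦃ m^n≢0 _ p ⦃ >-nonZero 1≤X ⦄ ⦄)
-- A chromatic number of at least 2 excludes both `Δ = 0` and `d = 0`.
theorem3p1 H d 0 (suc (suc _)) _ deg χ = contradiction (Δ≡0⇒chromatic≤1 H deg χ) λ { (s≤s ()) }
theorem3p1 H 0 (suc _) (suc (suc _)) _ deg χ = contradiction (chromatic≤1+d H deg χ) λ { (s≤s ()) }
theorem3p1 {n} H d@(suc _) Δ@(suc _) q@(suc (suc _)) 1≤n deg χ =
  let r , isRamsey , r≤N = ramsey-number H 1≤N (arrows-bound H 1≤n (s≤s z≤n) (s≤s z≤n) (s≤s z≤n) deg (proj₁ χ) E)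
  in r , isRamsey , le-real-pow X q
    (λ X≡0 → contradiction X≡0 (m<n⇒n≢0 1≤X))
    λ _ p e _ q^e≤ → ≤-trans (^-monoˡ-≤ e r≤N)
      (Numeric.bound d Δ q l a n p e (s≤s z≤n) (s≤s z≤n) q^e≤
        -- From `q ≥ 2` the logarithm is at least 1, that is `e ≤ p`.
        (subst (_≤ p) (*-identityˡ e) (below-log q 1 (s≤s (s≤s z≤n)) p e q^e≤))
        (a-log p e q^e≤) (l-log p e q^e≤) (k-log p e q^e≤) 2^l≤d)
  where
  E : Exponents d q
  E = exponents (s≤s (s≤s z≤n)) (chromatic≤1+d H deg χ)
  open Exponents E
  X L : ℕ
  X = 2 ^ (7 * d + 8) * d ^ (3 * d + 2) * Δ
  L = 2 * (8 * d * (q * q)) ^ d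
  1≤X : 1 ≤ X
  1≤X = *-mono-≤ (*-mono-≤ (m^n>0 2 (7 * d + 8)) (m^n>0 d (3 * d + 2))) (s≤s z≤n)
  1≤N : 1 ≤ L ^ suc l * Δ ^ a * (4 * n)
  1≤N = *-mono-≤ (*-mono-≤ (m^n>0 L ⦃ m*n≢0 2 _ ⦃ _ ⦄ ⦃ m^n≢0 (8 * d * (q * q)) d ⦄ ⦄ (suc l)) (m^n>0 Δ a))
    (*-mono-≤ (s≤s (z≤n {3})) 1≤n)
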